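{- Let $k\ge 2$ be an integer and $\varepsilon>0$. There exist constants $c=c(k,\varepsilon)>0$ and $n_0=n_0(k,\varepsilon)$ such that every graph $G$ on $n\ge n_0$ vertices with \[ q(G)\ge \left(1-\frac{1}{k}+\varepsilon\right)2n \] contains at least $c\,n^{k+1}$ copies of the complete graph $K_{k+1}$.
   Context: All graphs are finite, simple and undirected. For a graph $G$, $D(G)$ is the diagonal matrix of vertex degrees and $A(G)$ is the adjacency matrix; the signless Laplacian is $Q(G)=D(G)+A(G)$, and $q(G)$ denotes the largest eigenvalue of $Q(G)$ (the signless Laplacian spectral radius). $K_{k+1}$ is the complete graph on $k+1$ vertices; a copy of $K_{k+1}$ in $G$ is a set of $k+1$ pairwise adjacent vertices. -}

module Defs where

open import Algebra.Bundles.Raw using (RawMonoid)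
import Algebra.Definitions.RawMonoid as RawMonoidDefs
open import Data.Bool.Base using (if_then_else_)
open import Data.Fin.Base using (Fin)
open import Data.Fin.Properties using (all?) renaming (_≟_ to _≟ᶠ_)
open import Data.Fin.Subset using (Subset; inside; outside; _∈_; ∣_∣)
open import Data.Fin.Subset.Properties using (_∈?_)
open import Data.Integer.Base using (+_)
open import Data.List.Base as List using (List; []; _∷_; _++_; length; filter)
import Data.List.Membership.Propositional as ListMem
open import Data.List.Membership.Propositional.Properties
  using (∈-++⁺ˡ; ∈-++⁺ʳ; ∈-map⁺; ∈-map⁻)
open import Data.List.Relation.Unary.All using ([])
open import Data.List.Relation.Unary.Any using (here)
open import Data.List.Relation.Unary.AllPairs using ([]; _∷_)
open import Data.List.Relation.Unary.Unique.Propositional using (Unique)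
open import Data.List.Relation.Unary.Unique.Propositional.Properties
  using () renaming (++⁺ to Unique-++⁺; map⁺ to Unique-map⁺)
open import Data.Nat.Base as ℕ using (ℕ; zero; suc)
import Data.Nat.Properties as ℕₚ
open import Data.Product.Base using (_×_; _,_; proj₂; ∃-syntax)
open import Data.Rational.Base
  using (ℚ; 0ℚ; 1ℚ; ½; _+_; _*_; _-_; -_; _≤_; _<_; 1/_; _/_; Positive; NonZero;
         NonNegative; nonNegative; positive)
  renaming (∣_∣ to ∣_∣ℚ)
import Data.Rational.Properties as ℚₚ
open import Data.Rational.Solver using (module +-*-Solver)
import Data.Vec.Base as Vec
open import Data.Vec.Functional using (Vector)
open import Data.Vec.Properties using (∷-injectiveʳ)
open import Level using (0ℓ)
open import Relation.Binary.Core using (Rel)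
open import Relation.Binary.Definitions using (Decidable; Symmetric; Irreflexive)
open import Relation.Binary.PropositionalEquality
  using (_≡_; _≢_; refl; sym; trans; cong; cong₂; subst)
open import Relation.Nullary using (¬_; Dec; does; ¬?)
open import Relation.Nullary.Decidable using (_→-dec_; _×-dec_)
import Relation.Unary as U

-- Real numbers: Cauchy sequences of rationals, with equality _≈ᴿ_ meaning
-- that the difference is a null sequence.

Eventually : (ℕ → Set) → Set
Eventually P = ∃[ N ] (∀ n → N ℕ.≤ n → P n)

IsCauchy : (ℕ → ℚ) → Set
IsCauchy x = ∀ δ → 0ℚ < δ →
  ∃[ N ] (∀ m n → N ℕ.≤ m → N ℕ.≤ n → ∣ x m - x n ∣ℚ < δ)

record ℝ : Set where
  constructor mkℝ
  field
    seq    : ℕ → ℚ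
    cauchy : IsCauchy seq
open ℝ public

infix 4 _≈ᴿ_ _≤ᴿ_ _<ᴿ_

_≈ᴿ_ : Rel ℝ 0ℓ
x ≈ᴿ y = ∀ δ → 0ℚ < δ → Eventually λ n → ∣ seq x n - seq y n ∣ℚ < δ

_≤ᴿ_ : Rel ℝ 0ℓ
x ≤ᴿ y = ∀ δ → 0ℚ < δ → Eventually λ n → seq x n ≤ seq y n + δ

_<ᴿ_ : Rel ℝ 0ℓ
x <ᴿ y = ∃[ δ ] (0ℚ < δ × Eventually λ n → seq x n + δ ≤ seq y n)

private
  module _ where
    open +-*-Solver

    diff-+ : ∀ a b c d → (a + b) - (c + d) ≡ (a - c) + (b - d)
    diff-+ = solve 4 (λ a b c d → (a :+ b) :- (c :+ d) := (a :- c) :+ (b :- d)) refl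

    diff-* : ∀ a b c d → a * b - c * d ≡ a * (b - d) + d * (a - c)
    diff-* = solve 4 (λ a b c d → a :* b :- c :* d := a :* (b :- d) :+ d :* (a :- c)) refl

    split : ∀ a b → a ≡ b + (a - b)
    split = solve 2 (λ a b → a := b :+ (a :- b)) refl

  halves : ∀ δ → ½ * δ + ½ * δ ≡ δ
  halves δ = trans (sym (ℚₚ.*-distribʳ-+ δ ½ ½)) (ℚₚ.*-identityˡ δ)

  ½-pos : ∀ {δ} → 0ℚ < δ → 0ℚ < ½ * δ
  ½-pos {δ} 0<δ = ℚₚ.positive⁻¹ (½ * δ)
    {{ℚₚ.pos*pos⇒pos ½ δ {{positive 0<δ}}}}

  +-cauchy : ∀ {x y} → IsCauchy x → IsCauchy y → IsCauchy (λ n → x n + y n)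
  +-cauchy {x} {y} cx cy δ 0<δ
    with cx (½ * δ) (½-pos 0<δ) | cy (½ * δ) (½-pos 0<δ)
  ... | N , hx | M , hy = N ℕ.⊔ M , λ m n N⊔M≤m N⊔M≤n → begin-strict
    ∣ (x m + y m) - (x n + y n) ∣ℚ    ≡⟨ cong ∣_∣ℚ (diff-+ (x m) (y m) (x n) (y n)) ⟩
    ∣ (x m - x n) + (y m - y n) ∣ℚ    ≤⟨ ℚₚ.∣p+q∣≤∣p∣+∣q∣ (x m - x n) (y m - y n) ⟩
    ∣ x m - x n ∣ℚ + ∣ y m - y n ∣ℚ
      <⟨ ℚₚ.+-mono-<
           (hx m n (ℕₚ.m⊔n≤o⇒m≤o N M N⊔M≤m) (ℕₚ.m⊔n≤o⇒m≤o N M N⊔M≤n))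
           (hy m n (ℕₚ.m⊔n≤o⇒n≤o N M N⊔M≤m) (ℕₚ.m⊔n≤o⇒n≤o N M N⊔M≤n)) ⟩
    ½ * δ + ½ * δ                     ≡⟨ halves δ ⟩
    δ                                 ∎
    where open ℚₚ.≤-Reasoning

  EvBounded : (ℕ → ℚ) → Set
  EvBounded x = ∃[ B ] (0ℚ < B × Eventually λ n → ∣ x n ∣ℚ ≤ B)

  evBounded : ∀ {x} → IsCauchy x → EvBounded x
  evBounded {x} cx with cx 1ℚ (ℚₚ.positive⁻¹ 1ℚ)
  ... | N , h =
    ∣ x N ∣ℚ + 1ℚ
    , ℚₚ.+-mono-≤-< (ℚₚ.0≤∣p∣ (x N)) (ℚₚ.positive⁻¹ 1ℚ)
    , N , λ n N≤n → begin
      ∣ x n ∣ℚ                      ≡⟨ cong ∣_∣ℚ (split (x n) (x N)) ⟩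
      ∣ x N + (x n - x N) ∣ℚ        ≤⟨ ℚₚ.∣p+q∣≤∣p∣+∣q∣ (x N) (x n - x N) ⟩
      ∣ x N ∣ℚ + ∣ x n - x N ∣ℚ     ≤⟨ ℚₚ.+-monoʳ-≤ ∣ x N ∣ℚ (ℚₚ.<⇒≤ (h n N N≤n ℕₚ.≤-refl)) ⟩
      ∣ x N ∣ℚ + 1ℚ                 ∎
    where open ℚₚ.≤-Reasoning

  shrink : ∀ B δ → 0ℚ < B → 0ℚ < δ → ∃[ η ] (0ℚ < η × B * η ≡ ½ * δ)
  shrink B δ 0<B 0<δ = 1/ B * (½ * δ)
    , ℚₚ.positive⁻¹ _ {{ℚₚ.pos*pos⇒pos (1/ B) {{ℚₚ.1/pos⇒pos B}} (½ * δ) {{positive (½-pos 0<δ)}}}}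
    , trans (sym (ℚₚ.*-assoc B (1/ B) (½ * δ)))
        (trans (cong (_* (½ * δ)) (ℚₚ.*-inverseʳ B)) (ℚₚ.*-identityˡ (½ * δ)))
    where
    instance
      B-pos : Positive B
      B-pos = positive 0<B
      B-nz : NonZero B
      B-nz = ℚₚ.pos⇒nonZero B

  prod-bound : ∀ {B η} a b → 0ℚ < B → ∣ a ∣ℚ ≤ B → ∣ b ∣ℚ < η → ∣ a * b ∣ℚ < B * η
  prod-bound {B} {η} a b 0<B a≤B b<η = begin-strict
    ∣ a * b ∣ℚ         ≡⟨ ℚₚ.∣p*q∣≡∣p∣*∣q∣ a b ⟩
    ∣ a ∣ℚ * ∣ b ∣ℚ    ≤⟨ ℚₚ.*-monoʳ-≤-nonNeg ∣ b ∣ℚ {{nonNegative (ℚₚ.0≤∣p∣ b)}} a≤B ⟩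
    B * ∣ b ∣ℚ         <⟨ ℚₚ.*-monoʳ-<-pos B {{positive 0<B}} b<η ⟩
    B * η              ∎
    where open ℚₚ.≤-Reasoning

  prod-diff : ∀ {δ A η B θ} a b c d → 0ℚ < A → 0ℚ < B → A * η ≡ ½ * δ → B * θ ≡ ½ * δ →
              ∣ a ∣ℚ ≤ A → ∣ d ∣ℚ ≤ B → ∣ b - d ∣ℚ < η → ∣ a - c ∣ℚ < θ →
              ∣ a * b - c * d ∣ℚ < δ
  prod-diff {δ} {A} {η} {B} {θ} a b c d 0<A 0<B Aη Bθ a≤A d≤B b-d<η a-c<θ = begin-strict
    ∣ a * b - c * d ∣ℚ
      ≡⟨ cong ∣_∣ℚ (diff-* a b c d) ⟩
    ∣ a * (b - d) + d * (a - c) ∣ℚ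
      ≤⟨ ℚₚ.∣p+q∣≤∣p∣+∣q∣ (a * (b - d)) (d * (a - c)) ⟩
    ∣ a * (b - d) ∣ℚ + ∣ d * (a - c) ∣ℚ
      <⟨ ℚₚ.+-mono-< (prod-bound {A} {η} a (b - d) 0<A a≤A b-d<η)
                     (prod-bound {B} {θ} d (a - c) 0<B d≤B a-c<θ) ⟩
    A * η + B * θ     ≡⟨ cong₂ _+_ Aη Bθ ⟩
    ½ * δ + ½ * δ     ≡⟨ halves δ ⟩
    δ                 ∎
    where open ℚₚ.≤-Reasoning

  *-cauchy : ∀ {x y} → IsCauchy x → IsCauchy y → IsCauchy (λ n → x n * y n)
  *-cauchy {x} {y} cx cy δ 0<δ =
    let A , 0<A , Na , ha = evBounded cx
        B , 0<B , Nb , hb = evBounded cy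
        η , 0<η , Aη = shrink A δ 0<A 0<δ
        θ , 0<θ , Bθ = shrink B δ 0<B 0<δ
        Ny , hy = cy η 0<η
        Nx , hx = cx θ 0<θ
        P = Na ℕ.⊔ Nb
        Q = Ny ℕ.⊔ Nx
    in P ℕ.⊔ Q , λ m n N≤m N≤n →
      let P≤m = ℕₚ.m⊔n≤o⇒m≤o P Q N≤m
          P≤n = ℕₚ.m⊔n≤o⇒m≤o P Q N≤n
          Q≤m = ℕₚ.m⊔n≤o⇒n≤o P Q N≤m
          Q≤n = ℕₚ.m⊔n≤o⇒n≤o P Q N≤n
      in prod-diff {δ} {A} {η} {B} {θ} (x m) (y m) (x n) (y n) 0<A 0<B Aη Bθ
           (ha m (ℕₚ.m⊔n≤o⇒m≤o Na Nb P≤m)) (hb n (ℕₚ.m⊔n≤o⇒n≤o Na Nb P≤n))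
           (hy m n (ℕₚ.m⊔n≤o⇒m≤o Ny Nx Q≤m) (ℕₚ.m⊔n≤o⇒m≤o Ny Nx Q≤n))
           (hx m n (ℕₚ.m⊔n≤o⇒n≤o Ny Nx Q≤m) (ℕₚ.m⊔n≤o⇒n≤o Ny Nx Q≤n))

fromℚ : ℚ → ℝ
fromℚ q = mkℝ (λ _ → q) λ δ 0<δ → 0 , λ _ _ _ _ →
  subst (_< δ) (cong ∣_∣ℚ (sym (ℚₚ.+-inverseʳ q))) 0<δ

fromℕ : ℕ → ℝ
fromℕ n = fromℚ (+ n / 1)

0ᴿ 1ᴿ : ℝ
0ᴿ = fromℚ 0ℚ
1ᴿ = fromℚ 1ℚ

infixl 6 _+ᴿ_
infixl 7 _*ᴿ_

_+ᴿ_ _*ᴿ_ : ℝ → ℝ → ℝ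
x +ᴿ y = mkℝ (λ n → seq x n + seq y n) (+-cauchy {seq x} {seq y} (cauchy x) (cauchy y))
x *ᴿ y = mkℝ (λ n → seq x n * seq y n) (*-cauchy {seq x} {seq y} (cauchy x) (cauchy y))

+ᴿ-rawMonoid : RawMonoid 0ℓ 0ℓ
+ᴿ-rawMonoid = record { Carrier = ℝ ; _≈_ = _≈ᴿ_ ; _∙_ = _+ᴿ_ ; ε = 0ᴿ }

open RawMonoidDefs +ᴿ-rawMonoid public using () renaming (sum to sumᴿ)

SqMatrix : ℕ → Set
SqMatrix n = Fin n → Fin n → ℝ

infixl 7 _·_
_·_ : ∀ {n} → SqMatrix n → Vector ℝ n → Vector ℝ n
(M · v) i = sumᴿ λ j → M i j *ᴿ v j

IsEigenvalue : ∀ {n} → SqMatrix n → ℝ → Set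
IsEigenvalue M μ = ∃[ v ] (¬ (∀ i → v i ≈ᴿ 0ᴿ) × (∀ i → (M · v) i ≈ᴿ μ *ᴿ v i))

IsLargestEigenvalue : ∀ {n} → SqMatrix n → ℝ → Set
IsLargestEigenvalue M μ = IsEigenvalue M μ × (∀ ν → IsEigenvalue M ν → ν ≤ᴿ μ)

record Graph (n : ℕ) : Set₁ where
  field
    Adj    : Rel (Fin n) 0ℓ
    adj?   : Decidable Adj
    symm   : Symmetric Adj
    irrefl : Irreflexive _≡_ Adj

allSubsets : ∀ n → List (Subset n)
allSubsets zero    = Vec.[] ∷ []
allSubsets (suc n) =
  List.map (outside Vec.∷_) (allSubsets n) ++ List.map (inside Vec.∷_) (allSubsets n)

allSubsets-complete : ∀ {n} (S : Subset n) → S ListMem.∈ allSubsets n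
allSubsets-complete Vec.[]            = here refl
allSubsets-complete (outside Vec.∷ S) =
  ∈-++⁺ˡ (∈-map⁺ (outside Vec.∷_) (allSubsets-complete S))
allSubsets-complete (inside Vec.∷ S)  =
  ∈-++⁺ʳ (List.map (outside Vec.∷_) (allSubsets _)) (∈-map⁺ (inside Vec.∷_) (allSubsets-complete S))

allSubsets-unique : ∀ n → Unique (allSubsets n)
allSubsets-unique zero    = [] ∷ []
allSubsets-unique (suc n) = Unique-++⁺
  (Unique-map⁺ ∷-injectiveʳ (allSubsets-unique n))
  (Unique-map⁺ ∷-injectiveʳ (allSubsets-unique n))
  λ { (p , q) → disjoint (proj₂ (proj₂ (∈-map⁻ (outside Vec.∷_) p)))
                         (proj₂ (proj₂ (∈-map⁻ (inside Vec.∷_) q))) }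
  where
  disjoint : ∀ {S : Subset (suc n)} {T U : Subset n} →
             S ≡ outside Vec.∷ T → ¬ (S ≡ inside Vec.∷ U)
  disjoint refl ()

module _ {n : ℕ} (G : Graph n) where
  open Graph G

  degree : Fin n → ℕ
  degree u = Vec.count (adj? u) (Vec.allFin n)

  adjacencyMatrix degreeMatrix signlessLaplacian : SqMatrix n
  adjacencyMatrix u v = if does (adj? u v) then 1ᴿ else 0ᴿ
  degreeMatrix u v    = if does (u ≟ᶠ v) then fromℕ (degree u) else 0ᴿ
  signlessLaplacian u v = degreeMatrix u v +ᴿ adjacencyMatrix u v

  -- The relation "q = q(G)".  For n = 0 there is no eigenvalue and no such q.
  IsSignlessSpectralRadius : ℝ → Set
  IsSignlessSpectralRadius q = IsLargestEigenvalue signlessLaplacian q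

  IsCliqueCopy : ℕ → Subset n → Set
  IsCliqueCopy r S = ∣ S ∣ ≡ r × (∀ u v → u ∈ S → v ∈ S → u ≢ v → Adj u v)

  isCliqueCopy? : ∀ r → U.Decidable (IsCliqueCopy r)
  isCliqueCopy? r S = (∣ S ∣ ℕₚ.≟ r) ×-dec
    all? λ u → all? λ v → (u ∈? S) →-dec ((v ∈? S) →-dec (¬? (u ≟ᶠ v) →-dec adj? u v))

  #cliques : ℕ → ℕ
  #cliques r = length (filter (isCliqueCopy? r) (allSubsets n))

{-# OPTIONS --safe #-}
module Submission where

-- Every rational vector y defines on the weights p of total mass 1 a quadratic form F(p), the quadratic form
-- of Q weighted by p minus (2 - 2/k + small) ∑ p y².  Both F and the weighted count W(p) of (k+1)-cliques are
-- affine in p when mass is moved between two nonadjacent vertices, so an inequality const · F ≤ max y² · W has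
-- only to be checked when the support of p is a clique (Motzkin–Straus).  There, either k vertices carry
-- almost all the mass and F ≤ 0 by Cauchy–Schwarz, or any k vertices leave out a fixed proportion of the mass
-- and W is bounded below.  The theorem is the case of uniform p, with y an approximate eigenvector for q(G);
-- its entries are uniformly small because q(G) exceeds every degree by a constant times n.

open import Defs

-- Moving mass between nonadjacent vertices u and v is affine because each clique contains at most
-- one of them, at most once: no monomial has a factor p u p v or p u². The factor max y² explains
-- why small entries are needed. At uniform p the form F is at least a fixed multiple of S/n, where
-- S is the sum of the y², so a bound on W independent of n requires max y² to be of order S/n; a
-- concentrated y would lose a factor n. In the clique case the extremal weight puts 1/k on each of
-- k vertices. The small extra term in the coefficient 2 - 2/k pays for the mass that lies off those
-- vertices. Real numbers are Cauchy sequences, whose order is not decidable. The eigenvector is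
-- therefore read at a single index, where it is a rational vector satisfying the eigenvalue
-- equation up to an error e. This error must be small relative to S, hence relative to an entry
-- bounded away from 0. Such an entry is available only under a double negation, which suffices
-- because the conclusion compares two rationals.

module Supersaturation where
  open import Algebra.Bundles using (CommutativeRing)
  open import Data.Bool.Base using (true; false; if_then_else_)
  open import Data.Fin.Base using (Fin; zero; suc)
  import Data.Fin.Properties as Finₚ
  open import Data.Fin.Subset using (Subset; inside; outside; ⊥; ∣_∣)
    renaming (_∈_ to _∈ˢ_; _∉_ to _∉ˢ_)
  open import Data.Fin.Subset.Properties using (∉⊥; ∣⊥∣≡0) renaming (_∈?_ to _∈ˢ?_)
  import Data.Integer.Base as ℤ
  import Data.Integer.Properties as ℤₚ
  open import Data.List.Base as List using (List; []; _∷_; _++_; length; filter; allFin)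
  import Data.List.Properties as Listₚ
  import Data.List.Membership.DecPropositional as DecMembership
  open import Data.List.Membership.Propositional using (_∈_; _∉_; lose)
  open import Data.List.Membership.Propositional.Properties using (∈-filter⁺; ∈-allFin; ∈-length)
  open import Data.List.Relation.Unary.Any using (here; there)
  open import Data.Nat.Base as ℕ using (ℕ; zero; suc; _!)
  import Data.Nat.Properties as ℕₚ
  open import Data.Product.Base using (_×_; _,_; proj₁; proj₂)
  open import Data.Rational.Base renaming (∣_∣ to ∣_∣ℚ)
  import Data.Rational.Properties as ℚₚ
  import Data.Rational.Unnormalised.Base as ℚᵘ
  import Data.Rational.Unnormalised.Properties as ℚᵘₚ
  open import Data.Sum.Base using (inj₁; inj₂)
  open import Data.Vec.Base as Vec using (here; there; _[_]≔_)
  import Data.Vec.Properties as Vecₚ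
  open import Data.Unit.Base using (⊤; tt)
  open import Function.Base using (_∘_)
  open import Level using (0ℓ)
  open import Relation.Binary.PropositionalEquality
  open import Relation.Nullary using (¬_; Dec; yes; no; does; contradiction)
  open import Relation.Nullary.Decidable
    using (dec⇒maybe; decidable-stable; ¬?; dec-true; dec-false; _×-dec_; _→-dec_)
  open import Relation.Unary using (Pred; Decidable)
  open import Tactic.RingSolver using (solve-∀)
  open import Tactic.RingSolver.Core.AlmostCommutativeRing
    using (AlmostCommutativeRing; fromCommutativeRing)

  open module FinMembership {n} = DecMembership (Finₚ._≟_ {n}) using (_∈?_)
  open import Algebra.Properties.Semiring.Sum (CommutativeRing.semiring ℚₚ.+-*-commutativeRing)
    using (∑-distrib-+; *-distribˡ-sum; *-distribʳ-sum; sum-cong-≗; sum-replicate-zero)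
    renaming (sum to ∑)
  open import Algebra.Properties.Semiring.Exp (CommutativeRing.semiring ℚₚ.+-*-commutativeRing)
    using (_^_)


  -- Rational inequalities, finite sums and indicators.

  ℚ-ring : AlmostCommutativeRing 0ℓ 0ℓ
  ℚ-ring = fromCommutativeRing ℚₚ.+-*-commutativeRing (λ x → dec⇒maybe (0ℚ ℚₚ.≟ x))

  0≤1 : 0ℚ ≤ 1ℚ
  0≤1 = ℚₚ.nonNegative⁻¹ 1ℚ

  +-nonneg : ∀ {a b} → 0ℚ ≤ a → 0ℚ ≤ b → 0ℚ ≤ a + b
  +-nonneg = ℚₚ.+-mono-≤

  *-nonneg : ∀ {a b} → 0ℚ ≤ a → 0ℚ ≤ b → 0ℚ ≤ a * b
  *-nonneg {a} {b} 0≤a 0≤b = ℚₚ.nonNegative⁻¹ (a * b)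
    {{ℚₚ.nonNeg*nonNeg⇒nonNeg a {{nonNegative 0≤a}} b {{nonNegative 0≤b}}}}

  *-pos : ∀ {a b} → 0ℚ < a → 0ℚ < b → 0ℚ < a * b
  *-pos {a} {b} 0<a 0<b = ℚₚ.positive⁻¹ (a * b)
    {{ℚₚ.pos*pos⇒pos a {{positive 0<a}} b {{positive 0<b}}}}

  square-nonneg : ∀ a → 0ℚ ≤ a * a
  square-nonneg a with ℚₚ.≤-total 0ℚ a
  ... | inj₁ 0≤a = *-nonneg 0≤a 0≤a
  ... | inj₂ a≤0 = subst (0ℚ ≤_) (neg-square a) (*-nonneg 0≤-a 0≤-a)
    where
    0≤-a : 0ℚ ≤ - a
    0≤-a = ℚₚ.neg-antimono-≤ a≤0

    neg-square : ∀ a → (- a) * (- a) ≡ a * a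
    neg-square = solve-∀ ℚ-ring

  -- Many inequalities below are certified in this form: the ring solver checks an identity whose
  -- slack is built from visibly nonnegative factors.
  ≤-from-gap : ∀ {a b} d → 0ℚ ≤ d → b ≡ a + d → a ≤ b
  ≤-from-gap {a} d 0≤d refl = ℚₚ.≤-trans (ℚₚ.≤-reflexive (sym (ℚₚ.+-identityʳ a))) (ℚₚ.+-monoʳ-≤ a 0≤d)

  gap-nonneg : ∀ {a b} → a ≤ b → 0ℚ ≤ b - a
  gap-nonneg {a} {b} a≤b = subst (_≤ b - a) (ℚₚ.+-inverseʳ a) (ℚₚ.+-monoˡ-≤ (- a) a≤b)

  *-monoˡ : ∀ {a b c} → 0ℚ ≤ c → a ≤ b → c * a ≤ c * b
  *-monoˡ {c = c} 0≤c = ℚₚ.*-monoˡ-≤-nonNeg c {{nonNegative 0≤c}}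

  *-mono : ∀ {a b c d} → 0ℚ ≤ a → 0ℚ ≤ d → a ≤ b → c ≤ d → a * c ≤ b * d
  *-mono {a} {b} {c} {d} 0≤a 0≤d a≤b c≤d = ℚₚ.≤-trans (*-monoˡ 0≤a c≤d)
    (ℚₚ.*-monoʳ-≤-nonNeg d {{nonNegative 0≤d}} a≤b)

  *-cancelˡ : ∀ {a b c} → 0ℚ < c → c * a ≤ c * b → a ≤ b
  *-cancelˡ {c = c} 0<c = ℚₚ.*-cancelˡ-≤-pos c {{positive 0<c}}

  ^-nonneg : ∀ {a} → 0ℚ ≤ a → ∀ r → 0ℚ ≤ a ^ r
  ^-nonneg 0≤a zero    = 0≤1
  ^-nonneg 0≤a (suc r) = *-nonneg 0≤a (^-nonneg 0≤a r)

  ^-pos : ∀ {a} → 0ℚ < a → ∀ r → 0ℚ < a ^ r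
  ^-pos 0<a zero    = ℚₚ.positive⁻¹ 1ℚ
  ^-pos 0<a (suc r) = *-pos 0<a (^-pos 0<a r)

  ∑-mono : ∀ {n} {f g : Fin n → ℚ} → (∀ i → f i ≤ g i) → ∑ f ≤ ∑ g
  ∑-mono {zero}  f≤g = ℚₚ.≤-refl
  ∑-mono {suc n} f≤g = ℚₚ.+-mono-≤ (f≤g zero) (∑-mono (f≤g ∘ suc))

  ∑-nonneg : ∀ {n} {f : Fin n → ℚ} → (∀ i → 0ℚ ≤ f i) → 0ℚ ≤ ∑ f
  ∑-nonneg {n} {f} 0≤f = subst (_≤ ∑ f) (sum-replicate-zero n) (∑-mono 0≤f)

  ∑-*ˡ : ∀ {n} c (f : Fin n → ℚ) → ∑ (λ i → c * f i) ≡ c * ∑ f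
  ∑-*ˡ c f = sym (*-distribˡ-sum c f)

  ∑-linear₂ : ∀ {n} β α (f g : Fin n → ℚ) → ∑ (λ i → β * f i + α * g i) ≡ β * ∑ f + α * ∑ g
  ∑-linear₂ β α f g = trans (∑-distrib-+ (λ i → β * f i) (λ i → α * g i)) (cong₂ _+_ (∑-*ˡ β f) (∑-*ˡ α g))

  member≤∑ : ∀ {n} {f : Fin n → ℚ} → (∀ i → 0ℚ ≤ f i) → ∀ i → f i ≤ ∑ f
  member≤∑ {f = f} 0≤f zero    = ≤-from-gap _ (∑-nonneg (0≤f ∘ suc)) refl
  member≤∑ {f = f} 0≤f (suc i) = ℚₚ.≤-trans (member≤∑ (0≤f ∘ suc) i)
    (≤-from-gap (f zero) (0≤f zero) (ℚₚ.+-comm (f zero) _))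

  ⟦_⟧ : ∀ {P : Set} → Dec P → ℚ
  ⟦ P? ⟧ = if does P? then 1ℚ else 0ℚ

  ⟦⟧-true : ∀ {P : Set} (P? : Dec P) → P → ⟦ P? ⟧ ≡ 1ℚ
  ⟦⟧-true P? p rewrite dec-true P? p = refl

  ⟦⟧-false : ∀ {P : Set} (P? : Dec P) → ¬ P → ⟦ P? ⟧ ≡ 0ℚ
  ⟦⟧-false P? ¬p rewrite dec-false P? ¬p = refl

  ⟦⟧-nonneg : ∀ {P : Set} (P? : Dec P) → 0ℚ ≤ ⟦ P? ⟧
  ⟦⟧-nonneg P? with does P?
  ... | true  = 0≤1
  ... | false = ℚₚ.≤-refl

  ⟦⟧≤1 : ∀ {P : Set} (P? : Dec P) → ⟦ P? ⟧ ≤ 1ℚ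
  ⟦⟧≤1 P? with does P?
  ... | true  = ℚₚ.≤-refl
  ... | false = 0≤1

  ∑-diagonal : ∀ {n} (i : Fin n) (f : Fin n → ℚ) → ∑ (λ j → ⟦ i Finₚ.≟ j ⟧ * f j) ≡ f i
  ∑-diagonal {suc n} zero f = trans
    (cong₂ _+_ (ℚₚ.*-identityˡ (f zero))
      (trans (sum-cong-≗ (λ j → ℚₚ.*-zeroˡ (f (suc j)))) (sum-replicate-zero n)))
    (ℚₚ.+-identityʳ (f zero))
  ∑-diagonal {suc n} (suc i) f = trans
    (cong₂ _+_ (ℚₚ.*-zeroˡ (f zero)) (∑-diagonal i (f ∘ suc)))
    (ℚₚ.+-identityˡ (f (suc i)))

  -- Natural numbers as rationals, and powers.

  ι : ℕ → ℚ
  ι n = ℤ.+ n / 1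

  toℚᵘ-ι : ∀ n → toℚᵘ (ι n) ℚᵘ.≃ ℚᵘ.mkℚᵘ (ℤ.+ n) 0
  toℚᵘ-ι n = ℚₚ.toℚᵘ-fromℚᵘ (ℚᵘ.mkℚᵘ (ℤ.+ n) 0)

  ι-+ : ∀ m n → ι (m ℕ.+ n) ≡ ι m + ι n
  ι-+ m n = ℚₚ.toℚᵘ-injective (begin
    toℚᵘ (ι (m ℕ.+ n))                    ≈⟨ toℚᵘ-ι (m ℕ.+ n) ⟩
    ℚᵘ.mkℚᵘ (ℤ.+ (m ℕ.+ n)) 0
      ≈⟨ ℚᵘ.*≡* (cong (ℤ._* (ℤ.+ 1)) (sym (cong₂ ℤ._+_ (ℤₚ.*-identityʳ (ℤ.+ m)) (ℤₚ.*-identityʳ (ℤ.+ n))))) ⟩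
    ℚᵘ.mkℚᵘ (ℤ.+ m) 0 ℚᵘ.+ ℚᵘ.mkℚᵘ (ℤ.+ n) 0  ≈⟨ ℚᵘₚ.+-cong (toℚᵘ-ι m) (toℚᵘ-ι n) ⟨
    toℚᵘ (ι m) ℚᵘ.+ toℚᵘ (ι n)            ≈⟨ ℚₚ.toℚᵘ-homo-+ (ι m) (ι n) ⟨
    toℚᵘ (ι m + ι n)                      ∎)
    where open ℚᵘₚ.≃-Reasoning

  ι-* : ∀ m n → ι (m ℕ.* n) ≡ ι m * ι n
  ι-* m n = ℚₚ.toℚᵘ-injective (begin
    toℚᵘ (ι (m ℕ.* n))                    ≈⟨ toℚᵘ-ι (m ℕ.* n) ⟩
    ℚᵘ.mkℚᵘ (ℤ.+ (m ℕ.* n)) 0               ≈⟨ ℚᵘ.*≡* (cong (ℤ._* (ℤ.+ 1)) (ℤₚ.pos-* m n)) ⟩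
    ℚᵘ.mkℚᵘ (ℤ.+ m) 0 ℚᵘ.* ℚᵘ.mkℚᵘ (ℤ.+ n) 0  ≈⟨ ℚᵘₚ.*-cong (toℚᵘ-ι m) (toℚᵘ-ι n) ⟨
    toℚᵘ (ι m) ℚᵘ.* toℚᵘ (ι n)            ≈⟨ ℚₚ.toℚᵘ-homo-* (ι m) (ι n) ⟨
    toℚᵘ (ι m * ι n)                      ∎)
    where open ℚᵘₚ.≃-Reasoning

  ι-nonneg : ∀ n → 0ℚ ≤ ι n
  ι-nonneg n = ℚₚ.nonNegative⁻¹ (ι n) {{ℚₚ.normalize-nonNeg n 1}}

  ι-mono : ∀ {m n} → m ℕ.≤ n → ι m ≤ ι n
  ι-mono {m} {n} m≤n = ≤-from-gap (ι (n ℕ.∸ m)) (ι-nonneg (n ℕ.∸ m))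
    (trans (cong ι (sym (ℕₚ.m+[n∸m]≡n m≤n))) (ι-+ m (n ℕ.∸ m)))

  ι-pos : ∀ n → .{{ℕ.NonZero n}} → 0ℚ < ι n
  ι-pos n = ℚₚ.positive⁻¹ (ι n) {{ℚₚ.normalize-pos n 1}}

  ι-^ : ∀ n r → ι (n ℕ.^ r) ≡ ι n ^ r
  ι-^ n zero    = refl
  ι-^ n (suc r) = trans (ι-* n (n ℕ.^ r)) (cong (ι n *_) (ι-^ n r))

  ^-* : ∀ a b r → a ^ r * b ^ r ≡ (a * b) ^ r
  ^-* a b zero    = refl
  ^-* a b (suc r) = trans (swap a (a ^ r) b (b ^ r)) (cong (a * b *_) (^-* a b r))
    where
    swap : ∀ a a′ b b′ → a * a′ * (b * b′) ≡ a * b * (a′ * b′)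
    swap = solve-∀ ℚ-ring

  1^r≡1 : ∀ r → 1ℚ ^ r ≡ 1ℚ
  1^r≡1 zero    = refl
  1^r≡1 (suc r) = trans (ℚₚ.*-identityˡ _) (1^r≡1 r)

  -- Exchange of mass and functionals affine along it.

  Weight : ℕ → Set
  Weight n = Fin n → ℚ

  -- The convex combination keeps unnormalised coefficients, later `p v` and `p u`, so that all
  -- identities stay polynomial.
  record Exchange {n} (u v : Fin n) (β α : ℚ) (p p₀ p₁ : Weight n) : Set where
    field
      off : ∀ w → w ≢ u → w ≢ v → p₀ w ≡ p w × p₁ w ≡ p w
      mix : ∀ w → (β + α) * p w ≡ β * p₀ w + α * p₁ w

  -- `ext` replaces function extensionality, since exchanged weights often agree only pointwise.
  record AffineAlong {n} (u v : Fin n) (Φ : Weight n → ℚ) : Set where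
    field
      ext : ∀ {p p′} → (∀ i → p i ≡ p′ i) → Φ p ≡ Φ p′
      mix : ∀ {β α p p₀ p₁} → Exchange u v β α p p₀ p₁ → (β + α) * Φ p ≡ β * Φ p₀ + α * Φ p₁

  open Exchange
  open AffineAlong

  linear : ∀ {n} → Weight n → Weight n → ℚ
  linear z p = ∑ λ i → p i * z i

  -- Choose a vertex i, then reweight the rest by row i of `B`. The clique count and the quadratic
  -- form both arise from this operator, so one proof of affinity serves both.
  step : ∀ {n} → (Fin n → Weight n) → (Weight n → ℚ) → Weight n → ℚ
  step B Φ p = ∑ λ i → p i * Φ (λ j → B i j * p j)

  const-affine : ∀ {n} {u v : Fin n} c → AffineAlong u v (λ _ → c)
  const-affine c .ext _ = refl
  const-affine c .mix {β} {α} _ = ℚₚ.*-distribʳ-+ c β α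

  ∑-mix : ∀ {n} s β α (f g h : Weight n) → (∀ i → s * f i ≡ β * g i + α * h i) →
          s * ∑ f ≡ β * ∑ g + α * ∑ h
  ∑-mix s β α f g h eq = trans (*-distribˡ-sum s f) (trans (sum-cong-≗ eq) (∑-linear₂ β α g h))

  scale-mix : ∀ s β α c {x x₀ x₁} → s * x ≡ β * x₀ + α * x₁ →
              s * (c * x) ≡ β * (c * x₀) + α * (c * x₁)
  scale-mix s β α c {x} {x₀} {x₁} eq = trans (l s c x) (trans (cong (c *_) eq) (r c β α x₀ x₁))
    where
    l : ∀ s c x → s * (c * x) ≡ c * (s * x)
    l = solve-∀ ℚ-ring
    r : ∀ c β α x₀ x₁ → c * (β * x₀ + α * x₁) ≡ β * (c * x₀) + α * (c * x₁)
    r = solve-∀ ℚ-ring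

  scale-mixʳ : ∀ s β α c {x x₀ x₁} → s * x ≡ β * x₀ + α * x₁ →
               s * (x * c) ≡ β * (x₀ * c) + α * (x₁ * c)
  scale-mixʳ s β α c {x} {x₀} {x₁} eq = trans (l s c x) (trans (cong (_* c) eq) (r c β α x₀ x₁))
    where
    l : ∀ s c x → s * (x * c) ≡ s * x * c
    l = solve-∀ ℚ-ring
    r : ∀ c β α x₀ x₁ → (β * x₀ + α * x₁) * c ≡ β * (x₀ * c) + α * (x₁ * c)
    r = solve-∀ ℚ-ring

  linear-affine : ∀ {n} {u v : Fin n} z → AffineAlong u v (linear z)
  linear-affine z .ext eq = sum-cong-≗ λ i → cong (_* z i) (eq i)
  linear-affine z .mix {β} {α} x = ∑-mix (β + α) β α _ _ _ λ i → scale-mixʳ (β + α) β α (z i) (mix x i)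

  Exchange-scale : ∀ {n} {u v : Fin n} {β α p p₀ p₁} (c : Weight n) → Exchange u v β α p p₀ p₁ →
                   Exchange u v β α (λ j → c j * p j) (λ j → c j * p₀ j) (λ j → c j * p₁ j)
  Exchange-scale c x .off w w≢u w≢v =
    cong (c w *_) (proj₁ (off x w w≢u w≢v)) , cong (c w *_) (proj₂ (off x w w≢u w≢v))
  Exchange-scale {β = β} {α} c x .mix w = scale-mix (β + α) β α (c w) (mix x w)

  zero-* : ∀ {c} a b → c ≡ 0ℚ → c * a ≡ c * b
  zero-* a b refl = trans (ℚₚ.*-zeroˡ a) (sym (ℚₚ.*-zeroˡ b))

  Exchange-vanishing : ∀ {n} {u v : Fin n} {β α p p₀ p₁} (c : Weight n) → Exchange u v β α p p₀ p₁ →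
                       c u ≡ 0ℚ → c v ≡ 0ℚ →
                       ∀ j → c j * p₀ j ≡ c j * p j × c j * p₁ j ≡ c j * p j
  Exchange-vanishing {u = u} {v} {p = p} {p₀} {p₁} c x cu cv j with j Finₚ.≟ u | j Finₚ.≟ v
  ... | yes refl | _        = zero-* (p₀ j) (p j) cu , zero-* (p₁ j) (p j) cu
  ... | no _     | yes refl = zero-* (p₀ j) (p j) cv , zero-* (p₁ j) (p j) cv
  ... | no j≢u   | no j≢v   =
    cong (c j *_) (proj₁ (off x j j≢u j≢v)) , cong (c j *_) (proj₂ (off x j j≢u j≢v))

  -- The rows u and v of B ignore the exchange, and the other rows meet it only once.
  step-affine : ∀ {n} {u v : Fin n} B {Φ} →
                B u u ≡ 0ℚ → B u v ≡ 0ℚ → B v u ≡ 0ℚ → B v v ≡ 0ℚ →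
                AffineAlong u v Φ → AffineAlong u v (step B Φ)
  step-affine B uu uv vu vv aff .ext eq =
    sum-cong-≗ λ i → cong₂ _*_ (eq i) (ext aff λ j → cong (B i j *_) (eq j))
  step-affine {u = u} {v} B {Φ} uu uv vu vv aff .mix {β} {α} {p} {p₀} {p₁} x =
    ∑-mix (β + α) β α _ _ _ term
    where
    row : Weight _ → ∀ i → ℚ
    row p i = Φ (λ j → B i j * p j)

    frozen : ∀ i → B i u ≡ 0ℚ → B i v ≡ 0ℚ →
             (β + α) * (p i * row p i) ≡ β * (p₀ i * row p₀ i) + α * (p₁ i * row p₁ i)
    frozen i iu iv = subst₂
      (λ r₀ r₁ → (β + α) * (p i * row p i) ≡ β * (p₀ i * r₀) + α * (p₁ i * r₁))
      (ext aff λ j → sym (proj₁ (Exchange-vanishing (B i) x iu iv j)))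
      (ext aff λ j → sym (proj₂ (Exchange-vanishing (B i) x iu iv j)))
      (scale-mixʳ (β + α) β α (row p i) (mix x i))

    term : ∀ i → (β + α) * (p i * row p i) ≡ β * (p₀ i * row p₀ i) + α * (p₁ i * row p₁ i)
    term i with i Finₚ.≟ u | i Finₚ.≟ v
    ... | yes refl | _        = frozen i uu uv
    ... | no _     | yes refl = frozen i vu vv
    ... | no i≢u   | no i≢v
      rewrite proj₁ (off x i i≢u i≢v) | proj₂ (off x i i≢u i≢v) =
      scale-mix (β + α) β α (p i) (mix aff (Exchange-scale (B i) x))

  -- Cauchy-Schwarz for weights concentrated on few vertices.

  massOff : ∀ {n} → List (Fin n) → Weight n → ℚ
  massOff T p = ∑ λ i → (1ℚ - ⟦ i ∈? T ⟧) * p i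

  ∑-indicator : ∀ {n} (i : Fin n) → ∑ (λ j → ⟦ i Finₚ.≟ j ⟧) ≡ 1ℚ
  ∑-indicator i = trans (sum-cong-≗ λ j → sym (ℚₚ.*-identityʳ ⟦ i Finₚ.≟ j ⟧)) (∑-diagonal i (λ _ → 1ℚ))

  ∑-∈≤length : ∀ {n} (T : List (Fin n)) → ∑ (λ i → ⟦ i ∈? T ⟧) ≤ ι (length T)
  ∑-∈≤length {n} []      = ℚₚ.≤-reflexive (sum-replicate-zero n)
  ∑-∈≤length {n} (t ∷ T) = begin
    ∑ (λ i → ⟦ i ∈? t ∷ T ⟧)                             ≤⟨ ∑-mono term ⟩
    ∑ (λ i → ⟦ t Finₚ.≟ i ⟧ + ⟦ i ∈? T ⟧)
      ≡⟨ ∑-distrib-+ (λ i → ⟦ t Finₚ.≟ i ⟧) (λ i → ⟦ i ∈? T ⟧) ⟩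
    ∑ (λ i → ⟦ t Finₚ.≟ i ⟧) + ∑ (λ i → ⟦ i ∈? T ⟧)
      ≤⟨ ℚₚ.+-mono-≤ (ℚₚ.≤-reflexive (∑-indicator t)) (∑-∈≤length T) ⟩
    1ℚ + ι (length T)                                    ≡⟨ ι-+ 1 (length T) ⟨
    ι (suc (length T))                                   ∎
    where
    open ℚₚ.≤-Reasoning
    term : ∀ i → ⟦ i ∈? t ∷ T ⟧ ≤ ⟦ t Finₚ.≟ i ⟧ + ⟦ i ∈? T ⟧
    term i = go (i ∈? t ∷ T)
      where
      go : (d : Dec (i ∈ t ∷ T)) → ⟦ d ⟧ ≤ ⟦ t Finₚ.≟ i ⟧ + ⟦ i ∈? T ⟧
      go (no _)             = +-nonneg (⟦⟧-nonneg (t Finₚ.≟ i)) (⟦⟧-nonneg (i ∈? T))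
      go (yes (here i≡t))   = ≤-from-gap ⟦ i ∈? T ⟧ (⟦⟧-nonneg (i ∈? T))
        (cong (_+ ⟦ i ∈? T ⟧) (⟦⟧-true (t Finₚ.≟ i) (sym i≡t)))
      go (yes (there i∈T))  = ≤-from-gap ⟦ t Finₚ.≟ i ⟧ (⟦⟧-nonneg (t Finₚ.≟ i))
        (trans (ℚₚ.+-comm ⟦ t Finₚ.≟ i ⟧ _) (cong (_+ ⟦ t Finₚ.≟ i ⟧) (⟦⟧-true (i ∈? T) i∈T)))

  -- Cauchy–Schwarz in the form (∑ p y)² ≤ (∑ p w y²) (∑ p / w), with every p / w
  -- replaced by an upper bound for it, namely g / Γ.
  weighted-cauchy : ∀ {n} (p w y g : Weight n) Γ → 0ℚ < Γ → (∀ i → 0ℚ ≤ p i) → (∀ i → 0ℚ < w i) →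
                    (∀ i → Γ * p i ≤ w i * g i) → ∑ g ≤ Γ →
                    linear y p * linear y p ≤ ∑ (λ i → p i * (w i * (y i * y i)))
  weighted-cauchy p w y g Γ 0<Γ 0≤p 0<w bound ∑g≤Γ = *-cancelˡ 0<Γ (begin
    Γ * (M * M)                                   ≤⟨ ≤-from-gap _ gap (slack Γ (M * M) R (∑ g)) ⟩
    Γ * R                                         ∎)
    where
    open ℚₚ.≤-Reasoning
    M = linear y p
    R = ∑ (λ i → p i * (w i * (y i * y i)))

    slack : ∀ Γ m R g → Γ * R ≡ Γ * m + ((Γ * R + m * g - (Γ + Γ) * m) + m * (Γ - g))
    slack = solve-∀ ℚ-ring

    expand : ∀ Γ p w y m g →
      w * (Γ * (p * (w * (y * y))) + m * m * g - (Γ + Γ) * m * (p * y)) ≡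
      Γ * p * ((w * y - m) * (w * y - m)) + m * m * (w * g - Γ * p)
    expand = solve-∀ ℚ-ring

    -- Multiplying by `w i` completes a square and leaves a nonnegative multiple of the slack in
    -- `bound`; the positive factor `w i` then cancels.
    term : ∀ i → 0ℚ ≤ Γ * (p i * (w i * (y i * y i))) + M * M * g i - (Γ + Γ) * M * (p i * y i)
    term i = *-cancelˡ (0<w i) (subst₂ _≤_ (sym (ℚₚ.*-zeroʳ (w i))) (sym (expand Γ (p i) (w i) (y i) M (g i)))
      (+-nonneg (*-nonneg (*-nonneg (ℚₚ.<⇒≤ 0<Γ) (0≤p i)) (square-nonneg (w i * y i - M)))
                (*-nonneg (square-nonneg M) (gap-nonneg (bound i)))))

    collect : ∑ (λ i → Γ * (p i * (w i * (y i * y i))) + M * M * g i - (Γ + Γ) * M * (p i * y i))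
              ≡ Γ * R + M * M * ∑ g - (Γ + Γ) * (M * M)
    collect = trans
      (sum-cong-≗ λ i → cong ((Γ * (p i * (w i * (y i * y i))) + M * M * g i) +_)
        (neg-* ((Γ + Γ) * M) (p i * y i)))
      (trans (∑-distrib-+ (λ i → Γ * (p i * (w i * (y i * y i))) + M * M * g i) _)
        (trans (cong₂ _+_ (∑-linear₂ Γ (M * M) _ g) (∑-*ˡ (- ((Γ + Γ) * M)) (λ i → p i * y i)))
          (regroup (Γ * R + M * M * ∑ g) (Γ + Γ) M)))
      where
      neg-* : ∀ a b → - (a * b) ≡ (- a) * b
      neg-* = solve-∀ ℚ-ring
      regroup : ∀ a G m → a + (- (G * m)) * m ≡ a - G * (m * m)
      regroup = solve-∀ ℚ-ring

    gap : 0ℚ ≤ (Γ * R + M * M * ∑ g - (Γ + Γ) * (M * M)) + M * M * (Γ - ∑ g)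
    gap = +-nonneg (subst (0ℚ ≤_) collect (∑-nonneg term)) (*-nonneg (square-nonneg M) (gap-nonneg ∑g≤Γ))

  -- p / (c + 2p) is bounded on T by its tangent at p = h (h plays the role of 1/k), and off T by p / c.
  concentrated-bound : ∀ {n} (p y : Weight n) (T : List (Fin n)) {K : ℕ} {h κ c} →
    (∀ i → 0ℚ ≤ p i) → ∑ p ≡ 1ℚ → length T ℕ.≤ K → ι K * h ≡ 1ℚ → 0ℚ ≤ h →
    0ℚ < κ → κ ≤ 1ℚ → κ + κ ≤ c → c + (h + h) ≡ 1ℚ + (κ + κ) → massOff T p ≤ κ * κ →
    linear y p * linear y p ≤ ∑ (λ i → p i * ((c + (p i + p i)) * (y i * y i)))
  concentrated-bound p y T {K} {h} {κ} {c} 0≤p ∑p≡1 |T|≤K Kh≡1 0≤h 0<κ κ≤1 2κ≤c b≡ out≤ =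
    weighted-cauchy p w y g (c * (b * b)) (*-pos 0<c (*-pos 0<b 0<b)) 0≤p 0<w bound ∑g≤
    where
    open ℚₚ.≤-Reasoning
    b = c + (h + h)
    χ : Weight _
    χ i = ⟦ i ∈? T ⟧
    w g : Weight _
    w i = c + (p i + p i)
    -- With Γ = cb², this is Γ(h/b + c(p - h)/b²) on `T`, the scaled tangent, and Γp/c off `T`.
    g i = χ i * (c * ((h * h + h * h) + c * p i)) + (1ℚ - χ i) * (b * b * p i)

    0<c : 0ℚ < c
    0<c = ℚₚ.<-≤-trans (ℚₚ.+-mono-< 0<κ 0<κ) 2κ≤c
    0≤c = ℚₚ.<⇒≤ 0<c
    0≤κ = ℚₚ.<⇒≤ 0<κ

    0<b : 0ℚ < b
    0<b = ℚₚ.+-mono-<-≤ 0<c (+-nonneg 0≤h 0≤h)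

    0<w : ∀ i → 0ℚ < w i
    0<w i = ℚₚ.+-mono-<-≤ 0<c (+-nonneg (0≤p i) (0≤p i))

    onT : ∀ p → (c + (p + p)) * (1ℚ * (c * ((h * h + h * h) + c * p)) + (1ℚ - 1ℚ) * (b * b * p)) ≡
          c * (b * b) * p + (c * c + c * c) * ((p - h) * (p - h))
    onT p = identity c h p
      where
      identity : ∀ c h p →
        (c + (p + p)) * (1ℚ * (c * ((h * h + h * h) + c * p)) + (1ℚ - 1ℚ) * ((c + (h + h)) * (c + (h + h)) * p)) ≡
        c * ((c + (h + h)) * (c + (h + h))) * p + (c * c + c * c) * ((p - h) * (p - h))
      identity = solve-∀ ℚ-ring

    offT : ∀ c h b p → (c + (p + p)) * (0ℚ * (c * ((h * h + h * h) + c * p)) + (1ℚ - 0ℚ) * (b * b * p)) ≡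
           c * (b * b) * p + (b * p * (b * p) + b * p * (b * p))
    offT = solve-∀ ℚ-ring

    bound : ∀ i → c * (b * b) * p i ≤ w i * g i
    bound i with i ∈? T
    ... | yes _ = ≤-from-gap _
      (*-nonneg (+-nonneg (square-nonneg c) (square-nonneg c)) (square-nonneg (p i - h))) (onT (p i))
    ... | no _  = ≤-from-gap _
      (+-nonneg (square-nonneg (b * p i)) (square-nonneg (b * p i))) (offT c h b (p i))

    χp≤1 : ∑ (λ i → χ i * p i) ≤ 1ℚ
    χp≤1 = subst (∑ (λ i → χ i * p i) ≤_) ∑p≡1 (∑-mono λ i →
      ℚₚ.≤-trans (ℚₚ.*-monoʳ-≤-nonNeg (p i) {{nonNegative (0≤p i)}} (⟦⟧≤1 (i ∈? T)))
                 (ℚₚ.≤-reflexive (ℚₚ.*-identityˡ (p i))))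

    χ≤K : ∑ χ ≤ ι K
    χ≤K = ℚₚ.≤-trans (∑-∈≤length T) (ι-mono |T|≤K)

    spread : ∑ g ≡ c * (h * h + h * h) * ∑ χ + c * c * ∑ (λ i → χ i * p i) + b * b * massOff T p
    spread = trans (sum-cong-≗ λ i → terms c h (b * b) (χ i) (p i))
      (trans (∑-distrib-+ (λ i → c * (h * h + h * h) * χ i + c * c * (χ i * p i)) _)
        (cong₂ _+_ (∑-linear₂ (c * (h * h + h * h)) (c * c) χ (λ i → χ i * p i))
          (∑-*ˡ (b * b) (λ i → (1ℚ - χ i) * p i))))
      where
      terms : ∀ c h B χ p → χ * (c * ((h * h + h * h) + c * p)) + (1ℚ - χ) * (B * p) ≡
              (c * (h * h + h * h) * χ + c * c * (χ * p)) + B * ((1ℚ - χ) * p)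
      terms = solve-∀ ℚ-ring

    ∑g≤ : ∑ g ≤ c * (b * b)
    ∑g≤ = begin
      ∑ g  ≡⟨ spread ⟩
      c * (h * h + h * h) * ∑ χ + c * c * ∑ (λ i → χ i * p i) + b * b * massOff T p
        ≤⟨ ℚₚ.+-mono-≤ (ℚₚ.+-mono-≤
             (*-monoˡ (*-nonneg 0≤c (+-nonneg (square-nonneg h) (square-nonneg h))) χ≤K)
             (*-monoˡ (square-nonneg c) χp≤1))
             (*-monoˡ (square-nonneg b) out≤) ⟩
      c * (h * h + h * h) * ι K + c * c * 1ℚ + b * b * (κ * κ)
        ≡⟨ regroup c h (ι K) b κ ⟩
      c * (h * (ι K * h) + h * (ι K * h)) + c * c + b * b * (κ * κ)
        ≡⟨ cong (λ x → c * (h * x + h * x) + c * c + b * b * (κ * κ)) Kh≡1 ⟩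
      c * (h * 1ℚ + h * 1ℚ) + c * c + b * b * (κ * κ)
        ≡⟨ factor c h b κ ⟩
      c * b + b * (b * (κ * κ))
        ≡⟨ distrib b c κ ⟩
      b * (c + b * (κ * κ))
        ≤⟨ *-monoˡ (ℚₚ.<⇒≤ 0<b) small ⟩
      b * (c * b)
        ≡⟨ reorder b c ⟩
      c * (b * b) ∎
      where
      regroup : ∀ c h K b κ → c * (h * h + h * h) * K + c * c * 1ℚ + b * b * (κ * κ) ≡
                c * (h * (K * h) + h * (K * h)) + c * c + b * b * (κ * κ)
      regroup = solve-∀ ℚ-ring
      factor : ∀ c h b κ → c * (h * 1ℚ + h * 1ℚ) + c * c + b * b * (κ * κ) ≡
               c * (c + (h + h)) + b * (b * (κ * κ))
      factor = solve-∀ ℚ-ring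
      distrib : ∀ b c κ → c * b + b * (b * (κ * κ)) ≡ b * (c + b * (κ * κ))
      distrib = solve-∀ ℚ-ring
      reorder : ∀ b c → b * (c * b) ≡ c * (b * b)
      reorder = solve-∀ ℚ-ring
      identity : ∀ c κ → c * (1ℚ + (κ + κ)) ≡
        c + (1ℚ + (κ + κ)) * (κ * κ) + ((κ + κ) * (c - (κ + κ)) + κ * κ * (1ℚ + ((1ℚ - κ) + (1ℚ - κ))))
      identity = solve-∀ ℚ-ring
      -- This inequality is why the mass off `T` is required to be at most κ²: the gain 2κc is at
      -- least 4κ², and the loss (1 + 2κ)κ² is at most 3κ².
      small : c + b * (κ * κ) ≤ c * b
      small rewrite b≡ = ≤-from-gap _
        (+-nonneg (*-nonneg (+-nonneg 0≤κ 0≤κ) (gap-nonneg 2κ≤c))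
          (*-nonneg (square-nonneg κ) (+-nonneg 0≤1 (+-nonneg (gap-nonneg κ≤1) (gap-nonneg κ≤1)))))
        (identity c κ)

  -- Weighted clique counts and the edge form on a clique support.

  module Counting {n} (G : Graph n) where
    open Graph G

    a : Fin n → Weight n
    a i j = ⟦ adj? i j ⟧

    a-nonadj : ∀ {i j} → ¬ Adj i j → a i j ≡ 0ℚ
    a-nonadj {i} {j} = ⟦⟧-false (adj? i j)

    a-diag : ∀ i → a i i ≡ 0ℚ
    a-diag i = a-nonadj (irrefl refl)

    -- W r p is the sum of the weight products over all ordered r-cliques.
    W : ℕ → Weight n → ℚ
    W zero    = λ _ → 1ℚ
    W (suc r) = step a (W r)

    W-nonneg : ∀ r {p} → (∀ i → 0ℚ ≤ p i) → 0ℚ ≤ W r p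
    W-nonneg zero    0≤p = 0≤1
    W-nonneg (suc r) 0≤p =
      ∑-nonneg λ i → *-nonneg (0≤p i) (W-nonneg r λ j → *-nonneg (⟦⟧-nonneg (adj? i j)) (0≤p j))

    nonadj-affine : ∀ {u v} → ¬ Adj u v → (c : Fin n → Weight n) → ∀ {Φ} → AffineAlong u v Φ →
                    AffineAlong u v (step (λ i j → a i j * c i j) Φ)
    nonadj-affine {u} {v} ¬uv c = step-affine (λ i j → a i j * c i j)
      (vanish (a-diag u)) (vanish (a-nonadj ¬uv)) (vanish (a-nonadj (¬uv ∘ symm))) (vanish (a-diag v))
      where
      vanish : ∀ {i j} → a i j ≡ 0ℚ → a i j * c i j ≡ 0ℚ
      vanish {i} {j} eq = trans (cong (_* c i j) eq) (ℚₚ.*-zeroˡ (c i j))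

    W-affine : ∀ {u v} → ¬ Adj u v → ∀ r → AffineAlong u v (W r)
    W-affine         ¬uv zero    = const-affine 1ℚ
    W-affine {u} {v} ¬uv (suc r) = step-affine a
      (a-diag u) (a-nonadj ¬uv) (a-nonadj (¬uv ∘ symm)) (a-diag v) (W-affine ¬uv r)

    -- By the symmetry of a, y i * y i + y i * y j may stand for (y i + y j)² / 2.
    edgeForm : Weight n → Weight n → ℚ
    edgeForm y = step (λ i j → a i j * (y i * y i + y i * y j)) (linear (λ _ → 1ℚ))

    IsCliqueSupported : Weight n → Set
    IsCliqueSupported p = ∀ i j → i ≢ j → p i ≢ 0ℚ → p j ≢ 0ℚ → Adj i j

    module _ (p : Weight n) (0≤p : ∀ i → 0ℚ ≤ p i) (cl : IsCliqueSupported p) where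

      -- Cliques are chosen greedily, with `t` the vertices already taken. On a clique support,
      -- restricting to the neighbours of i loses only i itself, so `N` still dominates `p` off `t`.
      -- The size condition keeps `t` at length at most K whenever a further vertex is chosen, so
      -- mass at least δ remains available.
      W-lower : ∀ {δ K} → 0ℚ ≤ δ → (∀ T → length T ℕ.≤ K → δ ≤ massOff T p) →
                ∀ r t N → length t ℕ.+ r ℕ.≤ suc K → (∀ i → 0ℚ ≤ N i) → (∀ i → i ∉ t → p i ≤ N i) →
                δ ^ r ≤ W r N
      W-lower {δ} {K} 0≤δ out zero    t N size 0≤N p≤N = ℚₚ.≤-refl
      W-lower {δ} {K} 0≤δ out (suc r) t N size 0≤N p≤N = begin
        δ * δ ^ r
          ≤⟨ ℚₚ.*-monoʳ-≤-nonNeg (δ ^ r) {{nonNegative (^-nonneg 0≤δ r)}} (out t (ℕₚ.≤-pred size″)) ⟩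
        massOff t p * δ ^ r
          ≡⟨ *-distribʳ-sum (δ ^ r) (λ i → (1ℚ - ⟦ i ∈? t ⟧) * p i) ⟩
        ∑ (λ i → (1ℚ - ⟦ i ∈? t ⟧) * p i * δ ^ r)       ≤⟨ ∑-mono term ⟩
        W (suc r) N                                     ∎
        where
        open ℚₚ.≤-Reasoning
        size′ : suc (length t) ℕ.+ r ℕ.≤ suc K
        size′ = subst (ℕ._≤ suc K) (ℕₚ.+-suc (length t) r) size
        size″ : suc (length t) ℕ.≤ suc K
        size″ = ℕₚ.≤-trans (ℕₚ.m≤m+n (suc (length t)) r) size′
        N′ : ∀ i j → ℚ
        N′ i j = a i j * N j
        0≤N′ : ∀ i j → 0ℚ ≤ N′ i j
        0≤N′ i j = *-nonneg (⟦⟧-nonneg (adj? i j)) (0≤N j)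
        0≤term : ∀ i → 0ℚ ≤ N i * W r (N′ i)
        0≤term i = *-nonneg (0≤N i) (W-nonneg r (0≤N′ i))
        zeroˡ : ∀ x y → (1ℚ - 1ℚ) * x * y ≡ 0ℚ
        zeroˡ = solve-∀ ℚ-ring
        oneˡ : ∀ x → (1ℚ - 0ℚ) * x ≡ x
        oneˡ = solve-∀ ℚ-ring

        rest : ∀ i → p i ≢ 0ℚ → ∀ j → j ∉ i ∷ t → p j ≤ N′ i j
        rest i pi≢0 j j∉ with p j ℚₚ.≟ 0ℚ
        ... | yes pj≡0 = subst (_≤ N′ i j) (sym pj≡0) (0≤N′ i j)
        ... | no  pj≢0 = subst (p j ≤_)
          (trans (sym (ℚₚ.*-identityˡ (N j)))
            (cong (_* N j) (sym (⟦⟧-true (adj? i j) (cl i j (λ i≡j → j∉ (here (sym i≡j))) pi≢0 pj≢0)))))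
          (p≤N j (j∉ ∘ there))

        extend : ∀ i → p i ≤ N i → p i * δ ^ r ≤ N i * W r (N′ i)
        extend i pi≤Ni with p i ℚₚ.≟ 0ℚ
        ... | yes pi≡0 = subst (_≤ N i * W r (N′ i))
          (sym (trans (cong (_* δ ^ r) pi≡0) (ℚₚ.*-zeroˡ (δ ^ r)))) (0≤term i)
        ... | no  pi≢0 = *-mono (0≤p i) (W-nonneg r (0≤N′ i)) pi≤Ni
          (W-lower 0≤δ out r (i ∷ t) (N′ i) size′ (0≤N′ i) (rest i pi≢0))

        term : ∀ i → (1ℚ - ⟦ i ∈? t ⟧) * p i * δ ^ r ≤ N i * W r (N′ i)
        term i with i ∈? t
        ... | yes _   = subst (_≤ N i * W r (N′ i)) (sym (zeroˡ (p i) (δ ^ r))) (0≤term i)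
        ... | no  i∉t = subst (λ x → x * δ ^ r ≤ N i * W r (N′ i)) (sym (oneˡ (p i))) (extend i (p≤N i i∉t))

      -- On a clique support, adjacency excludes only the pairs i = j. Once these diagonal terms are
      -- added back, the double sum factors.
      clique-form : ∀ y → ∑ p ≡ 1ℚ →
        edgeForm y p + ∑ (λ i → p i * ((p i + p i) * (y i * y i))) ≡
        linear (λ i → y i * y i) p + linear y p * linear y p
      clique-form y ∑p≡1 = trans (sym (∑-distrib-+ (λ i → p i * ∑ (t i)) _))
        (trans (sum-cong-≗ row)
          (trans (∑-distrib-+ (λ i → p i * (y i * y i)) (λ i → M * (p i * y i)))
            (cong (linear (λ i → y i * y i) p +_) (∑-*ˡ M (λ i → p i * y i)))))
        where
        M = linear y p
        t : Fin n → Weight n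
        t i j = a i j * (y i * y i + y i * y j) * p j * 1ℚ

        z : Fin n → Weight n
        z i j = p i * ((y i * y i + y i * y j) * p j)

        zero₁ : ∀ a x q → 0ℚ * (a * x * q * 1ℚ) + 0ℚ * (0ℚ * (x * q)) ≡ 0ℚ * (x * q)
        zero₁ = solve-∀ ℚ-ring
        zero₂ : ∀ p a x → p * (a * x * 0ℚ * 1ℚ) + 0ℚ * (p * (x * 0ℚ)) ≡ p * (x * 0ℚ)
        zero₂ = solve-∀ ℚ-ring
        one : ∀ p x q → p * (1ℚ * x * q * 1ℚ) + 0ℚ * (p * (x * q)) ≡ p * (x * q)
        one = solve-∀ ℚ-ring
        diag : ∀ p x → p * (0ℚ * x * p * 1ℚ) + 1ℚ * (p * (x * p)) ≡ p * (x * p)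
        diag = solve-∀ ℚ-ring

        -- If either weight is 0 both sides vanish, so adjacency is needed only inside the support.
        entry : ∀ i j → p i * t i j + ⟦ i Finₚ.≟ j ⟧ * z i j ≡ z i j
        entry i j with i Finₚ.≟ j
        ... | yes refl rewrite a-diag i = diag (p i) (y i * y i + y i * y i)
        ... | no i≢j with p i ℚₚ.≟ 0ℚ | p j ℚₚ.≟ 0ℚ
        ...   | yes pi≡0 | _        rewrite pi≡0 = zero₁ (a i j) (y i * y i + y i * y j) (p j)
        ...   | no _     | yes pj≡0 rewrite pj≡0 = zero₂ (p i) (a i j) (y i * y i + y i * y j)
        ...   | no pi≢0  | no pj≢0
          rewrite ⟦⟧-true (adj? i j) (cl i j i≢j pi≢0 pj≢0) = one (p i) (y i * y i + y i * y j) (p j)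

        split-z : ∀ p y y′ q → p * ((y * y + y * y′) * q) ≡ p * (y * y) * q + p * y * (q * y′)
        split-z = solve-∀ ℚ-ring
        square : ∀ p y → p * ((p + p) * (y * y)) ≡ p * ((y * y + y * y) * p)
        square = solve-∀ ℚ-ring
        finish : ∀ p y M → p * (y * y) * 1ℚ + p * y * M ≡ p * (y * y) + M * (p * y)
        finish = solve-∀ ℚ-ring

        row : ∀ i → p i * ∑ (t i) + p i * ((p i + p i) * (y i * y i)) ≡ p i * (y i * y i) + M * (p i * y i)
        row i = begin
          p i * ∑ (t i) + p i * ((p i + p i) * (y i * y i))
            ≡⟨ cong₂ _+_ (*-distribˡ-sum (p i) (t i)) (trans (square (p i) (y i)) (sym (∑-diagonal i (z i)))) ⟩
          ∑ (λ j → p i * t i j) + ∑ (λ j → ⟦ i Finₚ.≟ j ⟧ * z i j)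
            ≡⟨ ∑-distrib-+ (λ j → p i * t i j) _ ⟨
          ∑ (λ j → p i * t i j + ⟦ i Finₚ.≟ j ⟧ * z i j)
            ≡⟨ sum-cong-≗ (λ j → trans (entry i j) (split-z (p i) (y i) (y j) (p j))) ⟩
          ∑ (λ j → p i * (y i * y i) * p j + p i * y i * (p j * y j))
            ≡⟨ ∑-linear₂ (p i * (y i * y i)) (p i * y i) p (λ j → p j * y j) ⟩
          p i * (y i * y i) * ∑ p + p i * y i * M
            ≡⟨ cong (λ s → p i * (y i * y i) * s + p i * y i * M) ∑p≡1 ⟩
          p i * (y i * y i) * 1ℚ + p i * y i * M
            ≡⟨ finish (p i) (y i) M ⟩
          p i * (y i * y i) + M * (p i * y i) ∎
          where open ≡-Reasoning

  -- Moving the whole mass of one vertex onto another.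

  transfer : ∀ {n} → Fin n → Fin n → Weight n → Weight n
  transfer u v p w = p w + p u * (⟦ v Finₚ.≟ w ⟧ - ⟦ u Finₚ.≟ w ⟧)

  transfer-source : ∀ {n} {u v : Fin n} → u ≢ v → ∀ p → transfer u v p u ≡ 0ℚ
  transfer-source {u = u} {v} u≢v p
    rewrite ⟦⟧-false (v Finₚ.≟ u) (u≢v ∘ sym) | ⟦⟧-true (u Finₚ.≟ u) refl = cancel (p u)
    where
    cancel : ∀ x → x + x * (0ℚ - 1ℚ) ≡ 0ℚ
    cancel = solve-∀ ℚ-ring

  transfer-other : ∀ {n} {u v w : Fin n} → w ≢ u → w ≢ v → ∀ p → transfer u v p w ≡ p w
  transfer-other {u = u} {v} {w} w≢u w≢v p
    rewrite ⟦⟧-false (v Finₚ.≟ w) (w≢v ∘ sym) | ⟦⟧-false (u Finₚ.≟ w) (w≢u ∘ sym) = nothing-moves (p w) (p u)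
    where
    nothing-moves : ∀ x y → x + y * (0ℚ - 0ℚ) ≡ x
    nothing-moves = solve-∀ ℚ-ring

  transfer-nonneg : ∀ {n} {u v : Fin n} → u ≢ v → ∀ {p} → (∀ i → 0ℚ ≤ p i) → ∀ w → 0ℚ ≤ transfer u v p w
  transfer-nonneg {u = u} {v} u≢v {p} 0≤p w = go (u Finₚ.≟ w)
    where
    go : Dec (u ≡ w) → 0ℚ ≤ transfer u v p w
    go (yes refl) = ℚₚ.≤-reflexive (sym (transfer-source u≢v p))
    go (no u≢w) rewrite ⟦⟧-false (u Finₚ.≟ w) u≢w =
      +-nonneg (0≤p w) (*-nonneg (0≤p u) (+-nonneg (⟦⟧-nonneg (v Finₚ.≟ w)) ℚₚ.≤-refl))

  transfer-∑ : ∀ {n} (u v : Fin n) p → ∑ (transfer u v p) ≡ ∑ p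
  transfer-∑ u v p = begin
    ∑ (transfer u v p)
      ≡⟨ sum-cong-≗ (λ w → expand (p w) (p u) ⟦ v Finₚ.≟ w ⟧ ⟦ u Finₚ.≟ w ⟧) ⟩
    ∑ (λ w → p w + (p u * ⟦ v Finₚ.≟ w ⟧ + (- p u) * ⟦ u Finₚ.≟ w ⟧))
      ≡⟨ ∑-distrib-+ p _ ⟩
    ∑ p + ∑ (λ w → p u * ⟦ v Finₚ.≟ w ⟧ + (- p u) * ⟦ u Finₚ.≟ w ⟧)
      ≡⟨ cong (∑ p +_) (∑-linear₂ (p u) (- p u) (λ w → ⟦ v Finₚ.≟ w ⟧) (λ w → ⟦ u Finₚ.≟ w ⟧)) ⟩
    ∑ p + (p u * ∑ (λ w → ⟦ v Finₚ.≟ w ⟧) + (- p u) * ∑ (λ w → ⟦ u Finₚ.≟ w ⟧))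
      ≡⟨ cong₂ (λ x y → ∑ p + (p u * x + (- p u) * y)) (∑-indicator v) (∑-indicator u) ⟩
    ∑ p + (p u * 1ℚ + (- p u) * 1ℚ)
      ≡⟨ cancel (∑ p) (p u) ⟩
    ∑ p ∎
    where
    open ≡-Reasoning
    expand : ∀ x y V U → x + y * (V - U) ≡ x + (y * V + (- y) * U)
    expand = solve-∀ ℚ-ring
    cancel : ∀ s x → s + (x * 1ℚ + (- x) * 1ℚ) ≡ s
    cancel = solve-∀ ℚ-ring

  -- On the segment between "all mass at v" and "all mass at u", the weight `p` has barycentric
  -- coordinates proportional to `p v` and `p u`.
  transfer-exchange : ∀ {n} (u v : Fin n) p → Exchange u v (p v) (p u) p (transfer u v p) (transfer v u p)
  transfer-exchange u v p .off w w≢u w≢v = transfer-other w≢u w≢v p , transfer-other w≢v w≢u p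
  transfer-exchange u v p .mix w = identity (p u) (p v) (p w) ⟦ u Finₚ.≟ w ⟧ ⟦ v Finₚ.≟ w ⟧
    where
    identity : ∀ x y z U V → (y + x) * z ≡ y * (z + x * (V - U)) + x * (z + y * (U - V))
    identity = solve-∀ ℚ-ring

  -- Since v is already in `t`, no vertex enters and u leaves; this decrease drives the induction.
  transfer-support : ∀ {n} {u v : Fin n} {p} (t : List (Fin n)) → u ≢ v → v ∈ t → (∀ i → i ∉ t → p i ≡ 0ℚ) →
                     ∀ i → i ∉ filter (¬? ∘ (u Finₚ.≟_)) t → transfer u v p i ≡ 0ℚ
  transfer-support {u = u} {v} {p} t u≢v v∈t supp i i∉ = go (u Finₚ.≟ i)
    where
    go : Dec (u ≡ i) → transfer u v p i ≡ 0ℚ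
    go (yes refl) = transfer-source u≢v p
    go (no u≢i)   = trans (transfer-other {v = v} (u≢i ∘ sym) (λ { refl → i∉t v∈t }) p) (supp i i∉t)
      where
      i∉t : i ∉ t
      i∉t i∈t = i∉ (∈-filter⁺ (¬? ∘ (u Finₚ.≟_)) i∈t u≢i)

  -- The supersaturation inequality by Motzkin-Straus induction.

  module Supersaturated {n} (G : Graph n) {K : ℕ} {h κ c τ Y : ℚ} (y : Weight n)
    (Kh≡1 : ι K * h ≡ 1ℚ) (0≤h : 0ℚ ≤ h) (0<κ : 0ℚ < κ) (κ≤1 : κ ≤ 1ℚ) (2κ≤c : κ + κ ≤ c)
    (b≡ : c + (h + h) ≡ 1ℚ + (κ + κ)) (0≤τ : 0ℚ ≤ τ) (y-bound : ∀ i → τ * (y i * y i) ≤ Y) (0≤Y : 0ℚ ≤ Y)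
    where
    open Graph G
    open Counting G

    -- `δ` separates concentrated from spread weights. `D` combines the two bounds of the spread
    -- case: δ^(K+1) ≤ W and τ M₁² ≤ Y.
    δ D : ℚ
    δ = κ * κ
    D = δ ^ suc K * τ

    M₂ : Weight n → ℚ
    M₂ = linear (λ i → y i * y i)

    0≤c : 0ℚ ≤ c
    0≤c = ℚₚ.≤-trans (+-nonneg (ℚₚ.<⇒≤ 0<κ) (ℚₚ.<⇒≤ 0<κ)) 2κ≤c

    0≤D : 0ℚ ≤ D
    0≤D = *-nonneg (^-nonneg (square-nonneg κ) (suc K)) 0≤τ

    -- By `b≡` the coefficient `1ℚ + c` is 2 - 2h + 2κ, so this is D F ≤ Y W with the negative part
    -- of F moved to the right.
    Goal : Weight n → Set
    Goal p = D * edgeForm y p ≤ D * ((1ℚ + c) * M₂ p) + Y * W (suc K) p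

    goal? : ∀ p → Dec (Goal p)
    goal? p = _ ℚₚ.≤? _

    module _ (p : Weight n) (0≤p : ∀ i → 0ℚ ≤ p i) (∑p≡1 : ∑ p ≡ 1ℚ) where
      M₁ R : ℚ
      M₁ = linear y p
      R  = ∑ λ i → p i * ((c + (p i + p i)) * (y i * y i))

      0≤YW : 0ℚ ≤ Y * W (suc K) p
      0≤YW = *-nonneg 0≤Y (W-nonneg (suc K) 0≤p)

      0≤R : 0ℚ ≤ R
      0≤R = ∑-nonneg λ i → *-nonneg (0≤p i)
        (*-nonneg (+-nonneg 0≤c (+-nonneg (0≤p i) (0≤p i))) (square-nonneg (y i)))

      -- The square of a mean is at most the mean of the squares, to which `y-bound` applies term by
      -- term.
      τM₁²≤Y : τ * (M₁ * M₁) ≤ Y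
      τM₁²≤Y = begin
        τ * (M₁ * M₁)
          ≤⟨ *-monoˡ 0≤τ (weighted-cauchy p (λ _ → 1ℚ) y p 1ℚ 0<1 0≤p (λ _ → 0<1) (λ i → ℚₚ.≤-refl) (ℚₚ.≤-reflexive ∑p≡1)) ⟩
        τ * ∑ (λ i → p i * (1ℚ * (y i * y i)))       ≡⟨ *-distribˡ-sum τ (λ i → p i * (1ℚ * (y i * y i))) ⟩
        ∑ (λ i → τ * (p i * (1ℚ * (y i * y i))))     ≡⟨ sum-cong-≗ (λ i → reorder τ (p i) (y i * y i)) ⟩
        ∑ (λ i → p i * (τ * (y i * y i)))            ≤⟨ ∑-mono (λ i → *-monoˡ (0≤p i) (y-bound i)) ⟩
        ∑ (λ i → p i * Y)                            ≡⟨ *-distribʳ-sum Y p ⟨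
        ∑ p * Y                                      ≡⟨ trans (cong (_* Y) ∑p≡1) (ℚₚ.*-identityˡ Y) ⟩
        Y                                            ∎
        where
        open ℚₚ.≤-Reasoning
        0<1 : 0ℚ < 1ℚ
        0<1 = ℚₚ.positive⁻¹ 1ℚ
        reorder : ∀ τ p z → τ * (p * (1ℚ * z)) ≡ p * (τ * z)
        reorder = solve-∀ ℚ-ring

      -- `R` gathers c M₂ and the diagonal terms, so on a clique F is exactly M₁² - R, the
      -- difference that `concentrated-bound` controls.
      clique-identity : IsCliqueSupported p → edgeForm y p ≡ (1ℚ + c) * M₂ p + (M₁ * M₁ - R)
      clique-identity cl = begin
        edgeForm y p                                   ≡⟨ insert (edgeForm y p) S ⟩
        (edgeForm y p + S) - S                         ≡⟨ cong (_- S) (clique-form p 0≤p cl y ∑p≡1) ⟩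
        (M₂ p + M₁ * M₁) - S                           ≡⟨ regroup c (M₂ p) (M₁ * M₁) S ⟩
        (1ℚ + c) * M₂ p + (M₁ * M₁ - (c * M₂ p + S))   ≡⟨ cong (λ r → (1ℚ + c) * M₂ p + (M₁ * M₁ - r)) R≡ ⟨
        (1ℚ + c) * M₂ p + (M₁ * M₁ - R)                ∎
        where
        open ≡-Reasoning
        S = ∑ λ i → p i * ((p i + p i) * (y i * y i))
        insert : ∀ x s → x ≡ (x + s) - s
        insert = solve-∀ ℚ-ring
        regroup : ∀ c m m₁ s → (m + m₁) - s ≡ (1ℚ + c) * m + (m₁ - (c * m + s))
        regroup = solve-∀ ℚ-ring
        split-c : ∀ c p q z → p * ((c + q) * z) ≡ c * (p * z) + p * (q * z)
        split-c = solve-∀ ℚ-ring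
        R≡ : R ≡ c * M₂ p + S
        R≡ = trans (sum-cong-≗ λ i → split-c c (p i) (p i + p i) (y i * y i))
          (trans (∑-distrib-+ (λ i → c * (p i * (y i * y i))) _)
            (cong (_+ S) (∑-*ˡ c (λ i → p i * (y i * y i)))))

      concentrated⇒goal : IsCliqueSupported p → ∀ T → length T ℕ.≤ K → massOff T p ≤ δ → Goal p
      concentrated⇒goal cl T |T|≤K out≤ = ≤-from-gap _ (+-nonneg (*-nonneg 0≤D (gap-nonneg M₁²≤R)) 0≤YW)
        (trans (slack D ((1ℚ + c) * M₂ p) (M₁ * M₁) R (Y * W (suc K) p))
          (cong (λ e → D * e + (D * (R - M₁ * M₁) + Y * W (suc K) p)) (sym (clique-identity cl))))
        where
        M₁²≤R : M₁ * M₁ ≤ R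
        M₁²≤R = concentrated-bound p y T 0≤p ∑p≡1 |T|≤K Kh≡1 0≤h 0<κ κ≤1 2κ≤c b≡ out≤
        slack : ∀ D m m₁ r w → D * m + w ≡ D * (m + (m₁ - r)) + (D * (r - m₁) + w)
        slack = solve-∀ ℚ-ring

      -- Here `R` is simply dropped: the cliques alone pay for M₁².
      spread⇒goal : IsCliqueSupported p → (∀ T → length T ℕ.≤ K → δ ≤ massOff T p) → Goal p
      spread⇒goal cl out = begin
        D * edgeForm y p                                 ≡⟨ cong (D *_) (clique-identity cl) ⟩
        D * ((1ℚ + c) * M₂ p + (M₁ * M₁ - R))
          ≤⟨ ≤-from-gap _ (*-nonneg 0≤D 0≤R) (slack (δ ^ suc K) τ ((1ℚ + c) * M₂ p) (M₁ * M₁) R) ⟩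
        D * ((1ℚ + c) * M₂ p) + δ ^ suc K * (τ * (M₁ * M₁))
          ≤⟨ ℚₚ.+-monoʳ-≤ (D * ((1ℚ + c) * M₂ p)) (*-mono (^-nonneg (square-nonneg κ) (suc K)) 0≤Y manyCliques τM₁²≤Y) ⟩
        D * ((1ℚ + c) * M₂ p) + W (suc K) p * Y
          ≡⟨ cong (D * ((1ℚ + c) * M₂ p) +_) (ℚₚ.*-comm (W (suc K) p) Y) ⟩
        D * ((1ℚ + c) * M₂ p) + Y * W (suc K) p          ∎
        where
        open ℚₚ.≤-Reasoning
        manyCliques : δ ^ suc K ≤ W (suc K) p
        manyCliques = W-lower p 0≤p cl (square-nonneg κ) out (suc K) [] p ℕₚ.≤-refl 0≤p (λ _ _ → ℚₚ.≤-refl)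
        slack : ∀ d t m m₁ r → d * t * m + d * (t * m₁) ≡ d * t * (m + (m₁ - r)) + d * t * r
        slack = solve-∀ ℚ-ring

      clique⇒goal : IsCliqueSupported p → Goal p
      -- Decidability of `Goal` lets the dichotomy run by contradiction, without a search for a list
      -- `T` carrying almost all the mass.
      clique⇒goal cl = decidable-stable (goal? p) λ ¬goal → ¬goal (spread⇒goal cl λ T |T|≤K →
        decidable-stable (_ ℚₚ.≤? _) λ δ≰out → ¬goal (concentrated⇒goal cl T |T|≤K (ℚₚ.<⇒≤ (ℚₚ.≰⇒> δ≰out))))

    exchange⇒goal : ∀ {u v} → ¬ Adj u v → ∀ {p} → (∀ i → 0ℚ ≤ p i) → p u ≢ 0ℚ →
                    Goal (transfer u v p) → Goal (transfer v u p) → Goal p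
    exchange⇒goal {u} {v} ¬uv {p} 0≤p pu≢0 goal₀ goal₁ = *-cancelˡ 0<s (begin
      s * (D * edgeForm y p)
        ≡⟨ scale-mix s (p v) (p u) D (mix (nonadj-affine ¬uv (λ i j → y i * y i + y i * y j) (linear-affine _)) x) ⟩
      p v * (D * edgeForm y p₀) + p u * (D * edgeForm y p₁)
        ≤⟨ ℚₚ.+-mono-≤ (*-monoˡ (0≤p v) goal₀) (*-monoˡ (0≤p u) goal₁) ⟩
      p v * (D * ((1ℚ + c) * M₂ p₀) + Y * W (suc K) p₀) + p u * (D * ((1ℚ + c) * M₂ p₁) + Y * W (suc K) p₁)
        ≡⟨ regroup (p v) (p u) (D * ((1ℚ + c) * M₂ p₀)) (Y * W (suc K) p₀) (D * ((1ℚ + c) * M₂ p₁)) (Y * W (suc K) p₁) ⟩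
      (p v * (D * ((1ℚ + c) * M₂ p₀)) + p u * (D * ((1ℚ + c) * M₂ p₁)))
        + (p v * (Y * W (suc K) p₀) + p u * (Y * W (suc K) p₁))
        ≡⟨ cong₂ _+_ (scale-mix s (p v) (p u) D (scale-mix s (p v) (p u) (1ℚ + c) (mix (linear-affine _) x)))
                     (scale-mix s (p v) (p u) Y (mix (W-affine ¬uv (suc K)) x)) ⟨
      s * (D * ((1ℚ + c) * M₂ p)) + s * (Y * W (suc K) p)
        ≡⟨ ℚₚ.*-distribˡ-+ s _ _ ⟨
      s * (D * ((1ℚ + c) * M₂ p) + Y * W (suc K) p) ∎)
      where
      open ℚₚ.≤-Reasoning
      s = p v + p u
      p₀ = transfer u v p
      p₁ = transfer v u p
      x = transfer-exchange u v p
      0<s : 0ℚ < s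
      0<s = ℚₚ.+-mono-≤-< (0≤p v) (ℚₚ.≰⇒> λ pu≤0 → pu≢0 (ℚₚ.≤-antisym pu≤0 (0≤p u)))
      regroup : ∀ v u a b c d → v * (a + b) + u * (c + d) ≡ (v * a + u * c) + (v * b + u * d)
      regroup = solve-∀ ℚ-ring

    -- Induction on a bound `m` for a list containing the support. A nonadjacent pair in the support
    -- yields two transfers with shorter lists; if there is none, the support is a clique.
    supported⇒goal : ∀ m t → length t ℕ.≤ m → ∀ p → (∀ i → 0ℚ ≤ p i) → ∑ p ≡ 1ℚ →
                     (∀ i → i ∉ t → p i ≡ 0ℚ) → Goal p
    supported⇒goal m t |t|≤m p 0≤p ∑p≡1 supp =
      decidable-stable (goal? p) λ ¬goal → ¬goal (clique⇒goal p 0≤p ∑p≡1 λ u v u≢v pu≢0 pv≢0 →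
        decidable-stable (adj? u v) λ ¬uv → ¬goal (merge m |t|≤m u≢v pu≢0 pv≢0 ¬uv))
      where
      in-support : ∀ i → p i ≢ 0ℚ → i ∈ t
      in-support i pi≢0 = decidable-stable (i ∈? t) (pi≢0 ∘ supp i)

      without : Fin n → List (Fin n)
      without u = filter (¬? ∘ (u Finₚ.≟_)) t

      without-length : ∀ {u m} → u ∈ t → length t ℕ.≤ suc m → length (without u) ℕ.≤ m
      without-length {u} u∈t |t|≤ = ℕₚ.≤-pred (ℕₚ.≤-trans
        (Listₚ.filter-notAll (¬? ∘ (u Finₚ.≟_)) t (lose u∈t (λ u≢u → u≢u refl))) |t|≤)

      merge : ∀ m → length t ℕ.≤ m → ∀ {u v} → u ≢ v → p u ≢ 0ℚ → p v ≢ 0ℚ → ¬ Adj u v → Goal p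
      merge zero    |t|≤0 {u}     u≢v pu≢0 pv≢0 ¬uv =
        contradiction (∈-length (in-support u pu≢0)) (ℕₚ.≤⇒≯ |t|≤0)
      merge (suc m) |t|≤ {u} {v} u≢v pu≢0 pv≢0 ¬uv = exchange⇒goal ¬uv 0≤p pu≢0
        (moved u v u≢v pu≢0 pv≢0) (moved v u (u≢v ∘ sym) pv≢0 pu≢0)
        where
        moved : ∀ u v → u ≢ v → p u ≢ 0ℚ → p v ≢ 0ℚ → Goal (transfer u v p)
        moved u v u≢v pu≢0 pv≢0 = supported⇒goal m (without u) (without-length (in-support u pu≢0) |t|≤)
          (transfer u v p) (transfer-nonneg u≢v 0≤p) (trans (transfer-∑ u v p) ∑p≡1)
          (transfer-support t u≢v (in-support v pv≢0) supp)

    supersaturation : ∀ p → (∀ i → 0ℚ ≤ p i) → ∑ p ≡ 1ℚ → Goal p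
    supersaturation p 0≤p ∑p≡1 = supported⇒goal _ (allFin n) ℕₚ.≤-refl p 0≤p ∑p≡1
      (λ i i∉ → contradiction (∈-allFin i) i∉)

  -- Weighted clique counts against numbers of clique copies.

  ⟦⟧-mono : ∀ {P Q : Set} (P? : Dec P) (Q? : Dec Q) → (P → Q) → ⟦ P? ⟧ ≤ ⟦ Q? ⟧
  ⟦⟧-mono (no _)  Q? f = ⟦⟧-nonneg Q?
  ⟦⟧-mono (yes p) Q? f = ℚₚ.≤-reflexive (sym (⟦⟧-true Q? (f p)))

  ⟦⟧-× : ∀ {P Q : Set} (P? : Dec P) (Q? : Dec Q) → ⟦ P? ×-dec Q? ⟧ ≡ ⟦ P? ⟧ * ⟦ Q? ⟧
  ⟦⟧-× P? Q? with does P?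
  ... | true  = sym (ℚₚ.*-identityˡ ⟦ Q? ⟧)
  ... | false = sym (ℚₚ.*-zeroˡ ⟦ Q? ⟧)

  sumOver : ∀ {A : Set} → List A → (A → ℚ) → ℚ
  sumOver []       f = 0ℚ
  sumOver (x ∷ xs) f = f x + sumOver xs f

  sumOver-++ : ∀ {A : Set} xs ys (f : A → ℚ) → sumOver (xs ++ ys) f ≡ sumOver xs f + sumOver ys f
  sumOver-++ []       ys f = sym (ℚₚ.+-identityˡ _)
  sumOver-++ (x ∷ xs) ys f = trans (cong (f x +_) (sumOver-++ xs ys f)) (sym (ℚₚ.+-assoc (f x) _ _))

  sumOver-map : ∀ {A B : Set} (g : A → B) xs (f : B → ℚ) → sumOver (List.map g xs) f ≡ sumOver xs (f ∘ g)
  sumOver-map g []       f = refl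
  sumOver-map g (x ∷ xs) f = cong (f (g x) +_) (sumOver-map g xs f)

  sumOver-mono : ∀ {A : Set} xs {f g : A → ℚ} → (∀ x → f x ≤ g x) → sumOver xs f ≤ sumOver xs g
  sumOver-mono []       f≤g = ℚₚ.≤-refl
  sumOver-mono (x ∷ xs) f≤g = ℚₚ.+-mono-≤ (f≤g x) (sumOver-mono xs f≤g)

  sumOver-cong : ∀ {A : Set} xs {f g : A → ℚ} → (∀ x → f x ≡ g x) → sumOver xs f ≡ sumOver xs g
  sumOver-cong []       f≡g = refl
  sumOver-cong (x ∷ xs) f≡g = cong₂ _+_ (f≡g x) (sumOver-cong xs f≡g)

  sumOver-*ˡ : ∀ {A : Set} xs c (f : A → ℚ) → sumOver xs (λ x → c * f x) ≡ c * sumOver xs f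
  sumOver-*ˡ []       c f = sym (ℚₚ.*-zeroʳ c)
  sumOver-*ˡ (x ∷ xs) c f = trans (cong (c * f x +_) (sumOver-*ˡ xs c f)) (sym (ℚₚ.*-distribˡ-+ c (f x) _))

  sumOver-nonneg : ∀ {A : Set} xs {f : A → ℚ} → (∀ x → 0ℚ ≤ f x) → 0ℚ ≤ sumOver xs f
  sumOver-nonneg []       0≤f = ℚₚ.≤-refl
  sumOver-nonneg (x ∷ xs) 0≤f = +-nonneg (0≤f x) (sumOver-nonneg xs 0≤f)

  member≤sumOver : ∀ {A : Set} {xs} {f : A → ℚ} → (∀ x → 0ℚ ≤ f x) → ∀ {x} → x ∈ xs → f x ≤ sumOver xs f
  member≤sumOver {xs = y ∷ xs} {f} 0≤f (here refl) = ≤-from-gap _ (sumOver-nonneg xs 0≤f) refl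
  member≤sumOver {xs = y ∷ xs} {f} 0≤f (there x∈)  = ℚₚ.≤-trans (member≤sumOver 0≤f x∈)
    (≤-from-gap (f y) (0≤f y) (ℚₚ.+-comm (f y) _))

  ∑-sumOver-swap : ∀ {A : Set} {n} xs (f : Fin n → A → ℚ) →
                   ∑ (λ i → sumOver xs (f i)) ≡ sumOver xs (λ x → ∑ λ i → f i x)
  ∑-sumOver-swap {n = n} []       f = sum-replicate-zero n
  ∑-sumOver-swap         (x ∷ xs) f = trans (∑-distrib-+ (λ i → f i x) (λ i → sumOver xs (f i)))
    (cong (∑ (λ i → f i x) +_) (∑-sumOver-swap xs f))

  ι-length-filter : ∀ {A : Set} {P : Pred A _} (P? : Decidable P) xs →
                    ι (length (filter P? xs)) ≡ sumOver xs (λ x → ⟦ P? x ⟧)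
  ι-length-filter P? []       = refl
  ι-length-filter P? (x ∷ xs) with does (P? x)
  ... | true  = trans (ι-+ 1 (length (filter P? xs))) (cong (1ℚ +_) (ι-length-filter P? xs))
  ... | false = trans (ι-length-filter P? xs) (sym (ℚₚ.+-identityˡ _))

  ∑ₛ : ∀ {n} → (Subset n → ℚ) → ℚ
  ∑ₛ {n} = sumOver (allSubsets n)

  ∑ₛ-suc : ∀ {n} (f : Subset (suc n) → ℚ) →
           ∑ₛ f ≡ ∑ₛ (λ S → f (outside Vec.∷ S)) + ∑ₛ (λ S → f (inside Vec.∷ S))
  ∑ₛ-suc {n} f = trans (sumOver-++ (List.map (outside Vec.∷_) (allSubsets n)) _ f)
    (cong₂ _+_ (sumOver-map _ (allSubsets n) f) (sumOver-map _ (allSubsets n) f))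

  -- Inserting u is a bijection from the sets without u to the sets with u, and the sum is reindexed
  -- along it.
  ∑ₛ-insert : ∀ {n} (u : Fin n) (g : Subset n → ℚ) →
              ∑ₛ (λ S → ⟦ ¬? (u ∈ˢ? S) ⟧ * g (S [ u ]≔ inside)) ≡ ∑ₛ (λ S → ⟦ u ∈ˢ? S ⟧ * g S)
  ∑ₛ-insert {suc n} zero g = begin
    ∑ₛ (λ S → ⟦ ¬? (zero ∈ˢ? S) ⟧ * g (S [ zero ]≔ inside))
      ≡⟨ ∑ₛ-suc (λ S → ⟦ ¬? (zero ∈ˢ? S) ⟧ * g (S [ zero ]≔ inside)) ⟩
    ∑ₛ (λ S → 1ℚ * g (inside Vec.∷ S)) + ∑ₛ (λ S → 0ℚ * g (inside Vec.∷ S))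
      ≡⟨ ℚₚ.+-comm (∑ₛ λ S → 1ℚ * g (inside Vec.∷ S)) _ ⟩
    ∑ₛ (λ S → 0ℚ * g (inside Vec.∷ S)) + ∑ₛ (λ S → 1ℚ * g (inside Vec.∷ S))
      ≡⟨ cong (_+ ∑ₛ (λ S → 1ℚ * g (inside Vec.∷ S)))
           (sumOver-cong (allSubsets n) λ S →
              trans (ℚₚ.*-zeroˡ (g (inside Vec.∷ S))) (sym (ℚₚ.*-zeroˡ (g (outside Vec.∷ S))))) ⟩
    ∑ₛ (λ S → 0ℚ * g (outside Vec.∷ S)) + ∑ₛ (λ S → 1ℚ * g (inside Vec.∷ S))
      ≡⟨ ∑ₛ-suc (λ S → ⟦ zero ∈ˢ? S ⟧ * g S) ⟨
    ∑ₛ (λ S → ⟦ zero ∈ˢ? S ⟧ * g S) ∎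
    where open ≡-Reasoning
  ∑ₛ-insert {suc n} (suc u) g = trans (∑ₛ-suc (λ S → ⟦ ¬? (suc u ∈ˢ? S) ⟧ * g (S [ suc u ]≔ inside)))
    (trans (cong₂ _+_ (∑ₛ-insert u (λ S → g (outside Vec.∷ S))) (∑ₛ-insert u (λ S → g (inside Vec.∷ S))))
      (sym (∑ₛ-suc (λ S → ⟦ suc u ∈ˢ? S ⟧ * g S))))

  ∑-∈≡size : ∀ {n} (S : Subset n) → ∑ (λ u → ⟦ u ∈ˢ? S ⟧) ≡ ι ∣ S ∣
  ∑-∈≡size Vec.[]            = refl
  ∑-∈≡size (inside Vec.∷ S)  = trans (cong (1ℚ +_) (∑-∈≡size S)) (sym (ι-+ 1 ∣ S ∣))
  ∑-∈≡size (outside Vec.∷ S) = trans (ℚₚ.+-identityˡ _) (∑-∈≡size S)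

  insert-size : ∀ {n} (u : Fin n) S → u ∉ˢ S → ∣ S [ u ]≔ inside ∣ ≡ suc ∣ S ∣
  insert-size zero    (inside Vec.∷ S)  u∉S = contradiction here u∉S
  insert-size zero    (outside Vec.∷ S) u∉S = refl
  insert-size (suc u) (inside Vec.∷ S)  u∉S = cong suc (insert-size u S (u∉S ∘ there))
  insert-size (suc u) (outside Vec.∷ S) u∉S = insert-size u S (u∉S ∘ there)

  ∈-insert⁻ : ∀ {n} {u v : Fin n} S → v ∈ˢ S [ u ]≔ inside → v ≢ u → v ∈ˢ S
  ∈-insert⁻ {u = u} {v} S v∈ v≢u = Vecₚ.lookup⇒[]= v S
    (trans (sym (Vecₚ.lookup∘update′ v≢u S inside)) (Vecₚ.[]=⇒lookup v∈))

  module CliqueCount {n} (G : Graph n) where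
    open Graph G
    open Counting G

    -- `P` carries the common neighbourhood of the vertices already chosen, so that sets can follow
    -- the recursion of `W`.
    CopyIn : ℕ → (Fin n → Set) → Subset n → Set
    CopyIn r P S = IsCliqueCopy G r S × (∀ u → u ∈ˢ S → P u)

    copyIn? : ∀ r {P : Fin n → Set} → Decidable P → Decidable (CopyIn r P)
    copyIn? r P? S = isCliqueCopy? G r S ×-dec Finₚ.all? λ u → (u ∈ˢ? S) →-dec P? u

    insert-copy : ∀ {r u} {P : Fin n → Set} {S} → P u → CopyIn r (λ v → Adj u v × P v) S →
                  u ∉ˢ S × CopyIn (suc r) P (S [ u ]≔ inside)
    insert-copy {r} {u} {P} {S} Pu ((size , clique) , nbr) =
      u∉S , (trans (insert-size u S u∉S) (cong suc size) , pairs) , inP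
      where
      u∉S : u ∉ˢ S
      u∉S u∈S = irrefl refl (proj₁ (nbr u u∈S))
      pairs : ∀ v w → v ∈ˢ S [ u ]≔ inside → w ∈ˢ S [ u ]≔ inside → v ≢ w → Adj v w
      pairs v w v∈ w∈ v≢w with v Finₚ.≟ u | w Finₚ.≟ u
      ... | yes refl | yes refl = contradiction refl v≢w
      ... | yes refl | no w≢u   = proj₁ (nbr w (∈-insert⁻ S w∈ w≢u))
      ... | no v≢u   | yes refl = symm (proj₁ (nbr v (∈-insert⁻ S v∈ v≢u)))
      ... | no v≢u   | no w≢u   = clique v w (∈-insert⁻ S v∈ v≢u) (∈-insert⁻ S w∈ w≢u) v≢w
      inP : ∀ v → v ∈ˢ S [ u ]≔ inside → P v
      inP v v∈ with v Finₚ.≟ u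
      ... | yes refl = Pu
      ... | no v≢u   = proj₂ (nbr v (∈-insert⁻ S v∈ v≢u))

    copies : ℕ → {P : Fin n → Set} → Decidable P → ℚ
    copies r P? = ∑ₛ λ S → ⟦ copyIn? r P? S ⟧

    nbr? : ∀ {P : Fin n → Set} → Decidable P → ∀ u → Decidable (λ v → Adj u v × P v)
    nbr? P? u v = adj? u v ×-dec P? v

    -- Double counting of pairs (u, S) with u in S: adding u to a clique among its neighbours
    -- injects into these pairs, and a clique on r + 1 vertices lies in r + 1 of them.
    copies-step : ∀ r {P : Fin n → Set} (P? : Decidable P) →
                  ∑ (λ u → ⟦ P? u ⟧ * copies r (nbr? P? u)) ≤ ι (suc r) * copies (suc r) P?
    copies-step r P? = begin
      ∑ (λ u → ⟦ P? u ⟧ * copies r (nbr? P? u))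
        ≡⟨ sum-cong-≗ (λ u → sumOver-*ˡ (allSubsets n) ⟦ P? u ⟧ (λ S → ⟦ copyIn? r (nbr? P? u) S ⟧)) ⟨
      ∑ (λ u → ∑ₛ λ S → ⟦ P? u ⟧ * ⟦ copyIn? r (nbr? P? u) S ⟧)
        ≤⟨ ∑-mono (λ u → sumOver-mono (allSubsets n) (insert u)) ⟩
      ∑ (λ u → ∑ₛ λ S → ⟦ ¬? (u ∈ˢ? S) ⟧ * g (S [ u ]≔ inside))
        ≡⟨ sum-cong-≗ (λ u → ∑ₛ-insert u g) ⟩
      ∑ (λ u → ∑ₛ λ S → ⟦ u ∈ˢ? S ⟧ * g S)
        ≡⟨ ∑-sumOver-swap (allSubsets n) (λ u S → ⟦ u ∈ˢ? S ⟧ * g S) ⟩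
      ∑ₛ (λ S → ∑ λ u → ⟦ u ∈ˢ? S ⟧ * g S)
        ≤⟨ sumOver-mono (allSubsets n) size ⟩
      ∑ₛ (λ S → ι (suc r) * g S)
        ≡⟨ sumOver-*ˡ (allSubsets n) (ι (suc r)) g ⟩
      ι (suc r) * copies (suc r) P? ∎
      where
      open ℚₚ.≤-Reasoning
      g : Subset n → ℚ
      g S = ⟦ copyIn? (suc r) P? S ⟧
      insert : ∀ u S → ⟦ P? u ⟧ * ⟦ copyIn? r (nbr? P? u) S ⟧ ≤ ⟦ ¬? (u ∈ˢ? S) ⟧ * g (S [ u ]≔ inside)
      insert u S = subst₂ _≤_
        (⟦⟧-× (P? u) (copyIn? r (nbr? P? u) S)) (⟦⟧-× (¬? (u ∈ˢ? S)) (copyIn? (suc r) P? (S [ u ]≔ inside)))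
        (⟦⟧-mono (P? u ×-dec copyIn? r (nbr? P? u) S) (¬? (u ∈ˢ? S) ×-dec copyIn? (suc r) P? (S [ u ]≔ inside))
          λ { (Pu , copy) → insert-copy Pu copy })
      weigh : ∀ S (d : Dec (CopyIn (suc r) _ S)) → ι ∣ S ∣ * ⟦ d ⟧ ≡ ι (suc r) * ⟦ d ⟧
      weigh S (yes ((size , _) , _)) = cong (λ s → ι s * 1ℚ) size
      weigh S (no _)                 = trans (ℚₚ.*-zeroʳ (ι ∣ S ∣)) (sym (ℚₚ.*-zeroʳ (ι (suc r))))
      size : ∀ S → ∑ (λ u → ⟦ u ∈ˢ? S ⟧ * g S) ≤ ι (suc r) * g S
      size S = ℚₚ.≤-reflexive (trans (sym (*-distribʳ-sum (g S) (λ u → ⟦ u ∈ˢ? S ⟧)))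
        (trans (cong (_* g S) (∑-∈≡size S)) (weigh S (copyIn? (suc r) P? S))))

    -- `W` sees orderings and `copies` sees sets, so each level contributes one factor of `r !`.
    -- Passing to a neighbourhood preserves the domination of `N` by c times an indicator.
    W≤copies : ∀ r {c} → 0ℚ ≤ c → ∀ {N} → (∀ i → 0ℚ ≤ N i) → ∀ {P : Fin n → Set} (P? : Decidable P) →
               (∀ i → N i ≤ c * ⟦ P? i ⟧) → W r N ≤ c ^ r * ι (r !) * copies r P?
    W≤copies zero {c} 0≤c 0≤N P? N≤ = begin
      1ℚ                          ≡⟨ ⟦⟧-true (copyIn? 0 P? ⊥) empty ⟨
      ⟦ copyIn? 0 P? ⊥ ⟧
        ≤⟨ member≤sumOver {f = λ S → ⟦ copyIn? 0 P? S ⟧} (λ S → ⟦⟧-nonneg (copyIn? 0 P? S)) (allSubsets-complete ⊥) ⟩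
      copies 0 P?                 ≡⟨ ℚₚ.*-identityˡ (copies 0 P?) ⟨
      1ℚ * copies 0 P?            ∎
      where
      open ℚₚ.≤-Reasoning
      empty : CopyIn 0 _ ⊥
      empty = (∣⊥∣≡0 n , λ u v u∈ → contradiction u∈ ∉⊥) , λ u u∈ → contradiction u∈ ∉⊥
    W≤copies (suc r) {c} 0≤c {N} 0≤N P? N≤ = begin
      W (suc r) N
        ≤⟨ ∑-mono (λ u → *-mono (0≤N u) (0≤rest u) (N≤ u) (W≤copies r 0≤c (0≤N′ u) (nbr? P? u) (N′≤ u))) ⟩
      ∑ (λ u → c * ⟦ P? u ⟧ * (c ^ r * ι (r !) * copies r (nbr? P? u)))
        ≡⟨ sum-cong-≗ (λ u → reorder c ⟦ P? u ⟧ (c ^ r) (ι (r !)) (copies r (nbr? P? u))) ⟩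
      ∑ (λ u → c * c ^ r * ι (r !) * (⟦ P? u ⟧ * copies r (nbr? P? u)))
        ≡⟨ ∑-*ˡ (c * c ^ r * ι (r !)) (λ u → ⟦ P? u ⟧ * copies r (nbr? P? u)) ⟩
      c * c ^ r * ι (r !) * ∑ (λ u → ⟦ P? u ⟧ * copies r (nbr? P? u))
        ≤⟨ *-monoˡ (*-nonneg (^-nonneg 0≤c (suc r)) (ι-nonneg (r !))) (copies-step r P?) ⟩
      c * c ^ r * ι (r !) * (ι (suc r) * copies (suc r) P?)
        ≡⟨ regroup (c * c ^ r) (ι (r !)) (ι (suc r)) (copies (suc r) P?) ⟩
      c * c ^ r * (ι (suc r) * ι (r !)) * copies (suc r) P?
        ≡⟨ cong (λ f → c * c ^ r * f * copies (suc r) P?) (ι-* (suc r) (r !)) ⟨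
      c * c ^ r * ι (suc r !) * copies (suc r) P? ∎
      where
      open ℚₚ.≤-Reasoning
      0≤N′ : ∀ u j → 0ℚ ≤ a u j * N j
      0≤N′ u j = *-nonneg (⟦⟧-nonneg (adj? u j)) (0≤N j)
      N′≤ : ∀ u j → a u j * N j ≤ c * ⟦ nbr? P? u j ⟧
      N′≤ u j = ℚₚ.≤-trans (*-monoˡ (⟦⟧-nonneg (adj? u j)) (N≤ j))
        (ℚₚ.≤-reflexive (trans (swap (a u j) c ⟦ P? j ⟧) (cong (c *_) (sym (⟦⟧-× (adj? u j) (P? j))))))
        where
        swap : ∀ a c p → a * (c * p) ≡ c * (a * p)
        swap = solve-∀ ℚ-ring
      0≤rest : ∀ u → 0ℚ ≤ c ^ r * ι (r !) * copies r (nbr? P? u)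
      0≤rest u = *-nonneg (*-nonneg (^-nonneg 0≤c r) (ι-nonneg (r !)))
        (sumOver-nonneg (allSubsets n) (λ S → ⟦⟧-nonneg (copyIn? r (nbr? P? u) S)))
      reorder : ∀ c p cr f x → c * p * (cr * f * x) ≡ c * cr * f * (p * x)
      reorder = solve-∀ ℚ-ring
      regroup : ∀ x f s y → x * f * (s * y) ≡ x * (s * f) * y
      regroup = solve-∀ ℚ-ring

    W-const≤#cliques : ∀ r {c} → 0ℚ ≤ c → W r (λ _ → c) ≤ c ^ r * ι (r !) * ι (#cliques G r)
    W-const≤#cliques r {c} 0≤c = ℚₚ.≤-trans
      (W≤copies r 0≤c (λ _ → 0≤c) {P = λ _ → ⊤} (λ _ → yes tt) (λ _ → ℚₚ.≤-reflexive (sym (ℚₚ.*-identityʳ c))))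
      (*-monoˡ (*-nonneg (^-nonneg 0≤c r) (ι-nonneg (r !))) (subst (copies r (λ _ → yes tt) ≤_)
        (sym (ι-length-filter (isCliqueCopy? G r) (allSubsets n)))
        (sumOver-mono (allSubsets n) λ S → ⟦⟧-mono (copyIn? r (λ _ → yes tt) S) (isCliqueCopy? G r S) proj₁)))

  -- Approximate eigenvectors and the uniform weight.

  ∑-const : ∀ n c → ∑ {n} (λ _ → c) ≡ ι n * c
  ∑-const zero    c = sym (ℚₚ.*-zeroˡ c)
  ∑-const (suc n) c = trans (cong (c +_) (∑-const n c))
    (trans (factor c (ι n)) (cong (_* c) (sym (ι-+ 1 n))))
    where
    factor : ∀ c x → c + x * c ≡ (1ℚ + x) * c
    factor = solve-∀ ℚ-ring

  square-mono : ∀ {a b} → 0ℚ ≤ a → a ≤ b → a * a ≤ b * b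
  square-mono 0≤a a≤b = *-mono 0≤a (ℚₚ.≤-trans 0≤a a≤b) a≤b a≤b

  module ApproximateEigenvector {n} .{{_ : ℕ.NonZero n}} (G : Graph n) {K : ℕ} {h η μ : ℚ} (y e : Weight n)
    (Kh≡1 : ι K * h ≡ 1ℚ) (0≤h : 0ℚ ≤ h) (2h≤1 : h + h ≤ 1ℚ)
    (0<η : 0ℚ < η) (κ≤1 : (η + η) + (η + η) ≤ 1ℚ) where
    open Graph G
    open Counting G
    open CliqueCount G

    -- `κ` is 4η because the excess 2κ = 8η of μ/n is spent in three parts: 2η inside `c`, 4η on the
    -- error of the eigenvalue equation, and 2η as the final gain.
    κ X m S : ℚ
    κ = (η + η) + (η + η)
    X = ι n
    S = ∑ λ i → y i * y i

    0<X : 0ℚ < X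
    0<X = ι-pos n

    instance
      X-pos : Positive X
      X-pos = positive 0<X
      X-nonZero : NonZero X
      X-nonZero = ℚₚ.pos⇒nonZero X

    m = 1/ X

    0<m : 0ℚ < m
    0<m = ℚₚ.positive⁻¹ m {{ℚₚ.1/pos⇒pos X}}

    Xm≡1 : X * m ≡ 1ℚ
    Xm≡1 = ℚₚ.*-inverseʳ X

    1≤X : 1ℚ ≤ X
    1≤X = ι-mono (ℕ.>-nonZero⁻¹ n)

    0<κ : 0ℚ < κ
    0<κ = ℚₚ.+-mono-< (ℚₚ.+-mono-< 0<η 0<η) (ℚₚ.+-mono-< 0<η 0<η)

    0≤κ : 0ℚ ≤ κ
    0≤κ = ℚₚ.<⇒≤ 0<κ

    κκ≤1 : κ * κ ≤ 1ℚ
    κκ≤1 = square-mono 0≤κ κ≤1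

    deg : Weight n
    deg i = ∑ (a i)

    0≤S : 0ℚ ≤ S
    0≤S = ∑-nonneg λ i → square-nonneg (y i)

    deg≤X : ∀ i → deg i ≤ X
    deg≤X i = ℚₚ.≤-trans (∑-mono λ j → ⟦⟧≤1 (adj? i j))
      (ℚₚ.≤-reflexive (trans (∑-const n 1ℚ) (ℚₚ.*-identityʳ X)))

    nbrSum : Weight n
    nbrSum i = ∑ λ j → a i j * y j

    nbrSum²≤ : ∀ i → nbrSum i * nbrSum i ≤ X * S
    nbrSum²≤ i = begin
      nbrSum i * nbrSum i
        ≤⟨ weighted-cauchy (a i) (λ _ → X) y (a i) X 0<X (λ j → ⟦⟧-nonneg (adj? i j)) (λ _ → 0<X) (λ _ → ℚₚ.≤-refl) (deg≤X i) ⟩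
      ∑ (λ j → a i j * (X * (y j * y j)))
        ≤⟨ ∑-mono (λ j → ℚₚ.≤-trans
             (ℚₚ.*-monoʳ-≤-nonNeg (X * (y j * y j)) {{nonNegative (*-nonneg (ℚₚ.<⇒≤ 0<X) (square-nonneg (y j)))}}
                (⟦⟧≤1 (adj? i j)))
             (ℚₚ.≤-reflexive (ℚₚ.*-identityˡ _))) ⟩
      ∑ (λ j → X * (y j * y j))
        ≡⟨ ∑-*ˡ X (λ j → y j * y j) ⟩
      X * S ∎
      where open ℚₚ.≤-Reasoning

    module _ (eigen : ∀ i → deg i * y i + nbrSum i ≡ μ * y i + e i)
             (e² : ∀ i → e i * e i ≤ κ * κ * S)
             (μ-large : ((1ℚ - h) + κ) * (X + X) ≤ μ) where

      -- Since 2h ≤ 1, μ exceeds each degree by at least 2κn. Hence (μ - deg) y = nbrSum - e bounds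
      -- y², with Cauchy-Schwarz giving nbrSum² ≤ nS.
      y-small : ∀ i → κ * κ * (y i * y i) ≤ m * S
      y-small i = begin
        κ * κ * (y i * y i)
          ≡⟨ trans (sym (ℚₚ.*-identityˡ _)) (cong (_* (κ * κ * (y i * y i))) (trans (sym Xm≡1) (ℚₚ.*-comm X m))) ⟩
        m * X * (κ * κ * (y i * y i))           ≡⟨ ℚₚ.*-assoc m X _ ⟩
        m * (X * (κ * κ * (y i * y i)))         ≤⟨ *-monoˡ (ℚₚ.<⇒≤ 0<m) (*-cancelˡ 0<4X scaled) ⟩
        m * S                                   ∎
        where
        open ℚₚ.≤-Reasoning
        4X = (X + X) + (X + X)
        0<4X : 0ℚ < 4X
        0<4X = ℚₚ.+-mono-< (ℚₚ.+-mono-< 0<X 0<X) (ℚₚ.+-mono-< 0<X 0<X)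
        Δ = μ - deg i

        Δ-large : κ * (X + X) ≤ Δ
        Δ-large = ≤-from-gap _
          (+-nonneg (+-nonneg (gap-nonneg μ-large) (gap-nonneg (deg≤X i))) (*-nonneg (ℚₚ.<⇒≤ 0<X) (gap-nonneg 2h≤1)))
          (slack μ (deg i) h κ X)
          where
          slack : ∀ μ d h κ X → μ - d ≡ κ * (X + X) + (((μ - ((1ℚ - h) + κ) * (X + X)) + (X - d)) + X * (1ℚ - (h + h)))
          slack = solve-∀ ℚ-ring

        Δy : Δ * y i ≡ nbrSum i - e i
        Δy = trans (l μ (deg i) (y i) (nbrSum i))
          (trans (cong (λ x → μ * y i - (x - nbrSum i)) (eigen i)) (r (μ * y i) (nbrSum i) (e i)))
          where
          l : ∀ μ d y s → (μ - d) * y ≡ μ * y - ((d * y + s) - s)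
          l = solve-∀ ℚ-ring
          r : ∀ z s e → z - ((z + e) - s) ≡ s - e
          r = solve-∀ ℚ-ring

        scaled : 4X * (X * (κ * κ * (y i * y i))) ≤ 4X * S
        scaled = begin
          4X * (X * (κ * κ * (y i * y i)))
            ≡⟨ regroup X κ (y i) ⟩
          κ * (X + X) * (κ * (X + X)) * (y i * y i)
            ≤⟨ ℚₚ.*-monoʳ-≤-nonNeg (y i * y i) {{nonNegative (square-nonneg (y i))}}
                 (square-mono (*-nonneg 0≤κ (+-nonneg (ℚₚ.<⇒≤ 0<X) (ℚₚ.<⇒≤ 0<X))) Δ-large) ⟩
          Δ * Δ * (y i * y i)
            ≡⟨ square-* Δ (y i) ⟩
          Δ * y i * (Δ * y i)
            ≡⟨ cong (λ x → x * x) Δy ⟩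
          (nbrSum i - e i) * (nbrSum i - e i)
            ≤⟨ ≤-from-gap _ (square-nonneg (nbrSum i + e i)) (parallelogram (nbrSum i) (e i)) ⟩
          (nbrSum i * nbrSum i + nbrSum i * nbrSum i) + (e i * e i + e i * e i)
            ≤⟨ ℚₚ.+-mono-≤ (ℚₚ.+-mono-≤ (nbrSum²≤ i) (nbrSum²≤ i)) (ℚₚ.+-mono-≤ e²≤XS e²≤XS) ⟩
          (X * S + X * S) + (X * S + X * S)
            ≡⟨ distrib X S ⟩
          4X * S ∎
          where
          e²≤XS : e i * e i ≤ X * S
          e²≤XS = ℚₚ.≤-trans (e² i) (ℚₚ.*-monoʳ-≤-nonNeg S {{nonNegative 0≤S}} (ℚₚ.≤-trans κκ≤1 1≤X))
          regroup : ∀ X κ y → ((X + X) + (X + X)) * (X * (κ * κ * (y * y))) ≡ κ * (X + X) * (κ * (X + X)) * (y * y)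
          regroup = solve-∀ ℚ-ring
          square-* : ∀ d y → d * d * (y * y) ≡ d * y * (d * y)
          square-* = solve-∀ ℚ-ring
          parallelogram : ∀ s e → (s * s + s * s) + (e * e + e * e) ≡ (s - e) * (s - e) + (s + e) * (s + e)
          parallelogram = solve-∀ ℚ-ring
          distrib : ∀ X S → (X * S + X * S) + (X * S + X * S) ≡ ((X + X) + (X + X)) * S
          distrib = solve-∀ ℚ-ring

      error : ℚ
      error = ∑ λ i → y i * e i

      -- Summing (κy + e)² ≥ 0 bounds ∑ y e below without square roots.
      error-small : 0ℚ ≤ error + κ * (X * S)
      error-small = *-cancelˡ (ℚₚ.+-mono-< 0<κ 0<κ) (begin
        (κ + κ) * 0ℚ
          ≡⟨ ℚₚ.*-zeroʳ (κ + κ) ⟩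
        0ℚ
          ≤⟨ ∑-nonneg term ⟩
        ∑ (λ i → ((κ + κ) * (y i * e i) + κ * κ * (y i * y i)) + κ * κ * S)
          ≡⟨ ∑-distrib-+ (λ i → (κ + κ) * (y i * e i) + κ * κ * (y i * y i)) (λ _ → κ * κ * S) ⟩
        ∑ (λ i → (κ + κ) * (y i * e i) + κ * κ * (y i * y i)) + ∑ (λ (_ : Fin n) → κ * κ * S)
          ≡⟨ cong₂ _+_ (∑-linear₂ (κ + κ) (κ * κ) (λ i → y i * e i) (λ i → y i * y i)) (∑-const n (κ * κ * S)) ⟩
        (κ + κ) * error + κ * κ * S + X * (κ * κ * S)
          ≤⟨ ≤-from-gap _ (*-nonneg (*-nonneg (square-nonneg κ) 0≤S) (gap-nonneg 1≤X)) (slack κ error S X) ⟩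
        (κ + κ) * (error + κ * (X * S)) ∎)
        where
        open ℚₚ.≤-Reasoning
        identity : ∀ κ y e z → ((κ + κ) * (y * e) + κ * κ * (y * y)) + z ≡ (κ * y + e) * (κ * y + e) + (z - e * e)
        identity = solve-∀ ℚ-ring
        term : ∀ i → 0ℚ ≤ ((κ + κ) * (y i * e i) + κ * κ * (y i * y i)) + κ * κ * S
        term i = subst (0ℚ ≤_) (sym (identity κ (y i) (e i) (κ * κ * S)))
          (+-nonneg (square-nonneg (κ * y i + e i)) (gap-nonneg (e² i)))
        slack : ∀ κ E S X → (κ + κ) * (E + κ * (X * S)) ≡
          ((κ + κ) * E + κ * κ * S + X * (κ * κ * S)) + κ * κ * S * (X - 1ℚ)
        slack = solve-∀ ℚ-ring

      uniform : Weight n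
      uniform _ = m

      -- Row i of the edge form is y i times (Qy) i, so the left side is m² times the quadratic form
      -- of Q at y.
      edgeForm-uniform : edgeForm y uniform ≡ m * m * (μ * S + error)
      edgeForm-uniform = begin
        edgeForm y uniform
          ≡⟨ sum-cong-≗ row ⟩
        ∑ (λ i → m * m * (μ * (y i * y i) + 1ℚ * (y i * e i)))
          ≡⟨ ∑-*ˡ (m * m) (λ i → μ * (y i * y i) + 1ℚ * (y i * e i)) ⟩
        m * m * ∑ (λ i → μ * (y i * y i) + 1ℚ * (y i * e i))
          ≡⟨ cong (m * m *_) (∑-linear₂ μ 1ℚ (λ i → y i * y i) (λ i → y i * e i)) ⟩
        m * m * (μ * S + 1ℚ * error)
          ≡⟨ cong (λ x → m * m * (μ * S + x)) (ℚₚ.*-identityˡ error) ⟩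
        m * m * (μ * S + error) ∎
        where
        open ≡-Reasoning
        entry : ∀ a y z m → a * (y * y + y * z) * m * 1ℚ ≡ m * (y * y) * a + m * y * (a * z)
        entry = solve-∀ ℚ-ring
        collect : ∀ m y d s → m * (m * (y * y) * d + m * y * s) ≡ m * m * (y * (d * y + s))
        collect = solve-∀ ℚ-ring
        expand : ∀ m y μ e → m * m * (y * (μ * y + e)) ≡ m * m * (μ * (y * y) + 1ℚ * (y * e))
        expand = solve-∀ ℚ-ring
        row : ∀ i → m * ∑ (λ j → a i j * (y i * y i + y i * y j) * m * 1ℚ) ≡ m * m * (μ * (y i * y i) + 1ℚ * (y i * e i))
        row i = begin
          m * ∑ (λ j → a i j * (y i * y i + y i * y j) * m * 1ℚ)
            ≡⟨ cong (m *_) (sum-cong-≗ λ j → entry (a i j) (y i) (y j) m) ⟩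
          m * ∑ (λ j → m * (y i * y i) * a i j + m * y i * (a i j * y j))
            ≡⟨ cong (m *_) (∑-linear₂ (m * (y i * y i)) (m * y i) (a i) (λ j → a i j * y j)) ⟩
          m * (m * (y i * y i) * deg i + m * y i * nbrSum i)
            ≡⟨ collect m (y i) (deg i) (nbrSum i) ⟩
          m * m * (y i * (deg i * y i + nbrSum i))
            ≡⟨ cong (λ x → m * m * (y i * x)) (eigen i) ⟩
          m * m * (y i * (μ * y i + e i))
            ≡⟨ expand m (y i) μ (e i) ⟩
          m * m * (μ * (y i * y i) + 1ℚ * (y i * e i)) ∎

      c : ℚ
      c = (1ℚ - (h + h)) + (η + η)

      edgeForm-large : (1ℚ + c) * (m * S) + (η + η) * (m * S) ≤ edgeForm y uniform
      edgeForm-large = subst₂ _≤_ simplify (sym edgeForm-uniform)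
        (*-monoˡ (square-nonneg m)
          (≤-from-gap _ (+-nonneg (*-nonneg 0≤S (gap-nonneg μ-large)) error-small) (slack μ S error h κ X)))
        where
        slack : ∀ μ S E h κ X → μ * S + E ≡
          X * (((1ℚ - h) + (1ℚ - h) + κ) * S) + (S * (μ - ((1ℚ - h) + κ) * (X + X)) + (E + κ * (X * S)))
        slack = solve-∀ ℚ-ring
        assoc : ∀ m X z → m * m * (X * z) ≡ X * m * (m * z)
        assoc = solve-∀ ℚ-ring
        regroup : ∀ h η m S → 1ℚ * (m * (((1ℚ - h) + (1ℚ - h) + ((η + η) + (η + η))) * S)) ≡
          (1ℚ + ((1ℚ - (h + h)) + (η + η))) * (m * S) + (η + η) * (m * S)
        regroup = solve-∀ ℚ-ring
        simplify : m * m * (X * (((1ℚ - h) + (1ℚ - h) + κ) * S)) ≡ (1ℚ + c) * (m * S) + (η + η) * (m * S)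
        simplify = trans (assoc m X _) (trans (cong (_* (m * (((1ℚ - h) + (1ℚ - h) + κ) * S))) Xm≡1) (regroup h η m S))

      D : ℚ
      D = (η * η) ^ suc K * (κ * κ)

      goal : D * edgeForm y uniform ≤ D * ((1ℚ + c) * linear (λ i → y i * y i) uniform) + m * S * W (suc K) uniform
      -- `η` plays the part of the general κ, while τ = κ² and Y = S/n are the constants of
      -- `y-small`.
      goal = Supersaturated.supersaturation G {K = K} {c = c} {τ = κ * κ} {Y = m * S} y Kh≡1 0≤h 0<η
        (ℚₚ.≤-trans (≤-from-gap _ (+-nonneg (ℚₚ.<⇒≤ 0<η) (+-nonneg (ℚₚ.<⇒≤ 0<η) (ℚₚ.<⇒≤ 0<η))) (regroup η)) κ≤1)
        (≤-from-gap _ (gap-nonneg 2h≤1) (ℚₚ.+-comm _ (η + η)))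
        (c≡ h η) (square-nonneg κ) y-small (*-nonneg (ℚₚ.<⇒≤ 0<m) 0≤S)
        uniform (λ _ → ℚₚ.<⇒≤ 0<m) (trans (∑-const n m) Xm≡1)
        where
        regroup : ∀ η → (η + η) + (η + η) ≡ η + (η + (η + η))
        regroup = solve-∀ ℚ-ring
        c≡ : ∀ h η → (1ℚ - (h + h)) + (η + η) + (h + h) ≡ 1ℚ + (η + η)
        c≡ = solve-∀ ℚ-ring

      module _ (0<S : 0ℚ < S) where
        0≤D : 0ℚ ≤ D
        0≤D = *-nonneg (^-nonneg (square-nonneg η) (suc K)) (square-nonneg κ)

        -- After the terms with `1ℚ + c` cancel, both sides carry the factor S/n; dividing by it
        -- leaves a bound free of y and n.
        W-large : D * (η + η) ≤ W (suc K) uniform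
        W-large = *-cancelˡ (*-pos 0<m 0<S)
          (subst (_≤ m * S * W (suc K) uniform) (regroup D (η + η) (m * S)) (cancel (D * ((1ℚ + c) * (m * S))) (begin
          D * ((1ℚ + c) * (m * S)) + D * ((η + η) * (m * S))
            ≡⟨ ℚₚ.*-distribˡ-+ D _ _ ⟨
          D * ((1ℚ + c) * (m * S) + (η + η) * (m * S))
            ≤⟨ *-monoˡ 0≤D edgeForm-large ⟩
          D * edgeForm y uniform
            ≤⟨ goal ⟩
          D * ((1ℚ + c) * linear (λ i → y i * y i) uniform) + m * S * W (suc K) uniform
            ≡⟨ cong (λ x → D * ((1ℚ + c) * x) + m * S * W (suc K) uniform) (∑-*ˡ m (λ i → y i * y i)) ⟩
          D * ((1ℚ + c) * (m * S)) + m * S * W (suc K) uniform ∎)))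
          where
          open ℚₚ.≤-Reasoning
          regroup : ∀ D x s → D * (x * s) ≡ s * (D * x)
          regroup = solve-∀ ℚ-ring
          cancel : ∀ x {b w} → x + b ≤ x + w → b ≤ w
          cancel x {b} {w} le = subst₂ _≤_ (drop x b) (drop x w) (ℚₚ.+-monoʳ-≤ (- x) le)
            where
            drop : ∀ x b → - x + (x + b) ≡ b
            drop = solve-∀ ℚ-ring

        cliques-large : D * (η + η) * ι (n ℕ.^ suc K) ≤ ι (suc K !) * ι (#cliques G (suc K))
        cliques-large = begin
          D * (η + η) * ι (n ℕ.^ suc K)
            ≡⟨ cong (D * (η + η) *_) (ι-^ n (suc K)) ⟩
          D * (η + η) * X ^ suc K
            ≤⟨ ℚₚ.*-monoʳ-≤-nonNeg (X ^ suc K) {{nonNegative (^-nonneg (ℚₚ.<⇒≤ 0<X) (suc K))}}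
                 (ℚₚ.≤-trans W-large (W-const≤#cliques (suc K) (ℚₚ.<⇒≤ 0<m))) ⟩
          m ^ suc K * ι (suc K !) * ι (#cliques G (suc K)) * X ^ suc K
            ≡⟨ regroup (m ^ suc K) (ι (suc K !)) (ι (#cliques G (suc K))) (X ^ suc K) ⟩
          X ^ suc K * m ^ suc K * (ι (suc K !) * ι (#cliques G (suc K)))
            ≡⟨ cong (_* (ι (suc K !) * ι (#cliques G (suc K))))
                 (trans (^-* X m (suc K)) (trans (cong (_^ suc K) Xm≡1) (1^r≡1 (suc K)))) ⟩
          1ℚ * (ι (suc K !) * ι (#cliques G (suc K)))
            ≡⟨ ℚₚ.*-identityˡ _ ⟩
          ι (suc K !) * ι (#cliques G (suc K)) ∎
          where
          open ℚₚ.≤-Reasoning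
          regroup : ∀ M f q X → M * f * q * X ≡ X * M * (f * q)
          regroup = solve-∀ ℚ-ring

  -- From real numbers to rational approximations.

  1/k-inverse : ∀ k .{{_ : ℕ.NonZero k}} → ι k * (ℤ.+ 1 / k) ≡ 1ℚ
  1/k-inverse (suc k) = ℚₚ.toℚᵘ-injective (begin
    toℚᵘ (ι (suc k) * (ℤ.+ 1 / suc k))                ≈⟨ ℚₚ.toℚᵘ-homo-* (ι (suc k)) (ℤ.+ 1 / suc k) ⟩
    toℚᵘ (ι (suc k)) ℚᵘ.* toℚᵘ (ℤ.+ 1 / suc k)
      ≈⟨ ℚᵘₚ.*-cong (toℚᵘ-ι (suc k)) (ℚₚ.toℚᵘ-fromℚᵘ (ℚᵘ.mkℚᵘ (ℤ.+ 1) k)) ⟩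
    ℚᵘ.mkℚᵘ (ℤ.+ suc k) 0 ℚᵘ.* ℚᵘ.mkℚᵘ (ℤ.+ 1) k      ≈⟨ ℚᵘ.*≡* (cong ℤ.+_ (identity k)) ⟩
    toℚᵘ 1ℚ                                           ∎)
    where
    open ℚᵘₚ.≃-Reasoning
    identity : ∀ k → suc k ℕ.* 1 ℕ.* 1 ≡ 1 ℕ.* (1 ℕ.* suc k)
    identity k = trans (ℕₚ.*-identityʳ (suc k ℕ.* 1))
      (trans (ℕₚ.*-comm (suc k) 1) (sym (ℕₚ.*-identityˡ (1 ℕ.* suc k))))

  ∣x∣²≡x² : ∀ x → ∣ x ∣ℚ * ∣ x ∣ℚ ≡ x * x
  ∣x∣²≡x² x = trans (sym (ℚₚ.∣p*q∣≡∣p∣*∣q∣ x x)) (ℚₚ.0≤p⇒∣p∣≡p (square-nonneg x))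

  Eventually-× : ∀ {P Q : ℕ → Set} → Eventually P → Eventually Q → Eventually (λ N → P N × Q N)
  Eventually-× (M , p) (N , q) = M ℕ.⊔ N , λ n le →
    p n (ℕₚ.m⊔n≤o⇒m≤o M N le) , q n (ℕₚ.m⊔n≤o⇒n≤o M N le)

  Eventually-∀ : ∀ {m} {P : Fin m → ℕ → Set} → (∀ i → Eventually (P i)) → Eventually (λ N → ∀ i → P i N)
  Eventually-∀ {zero}  h = 0 , λ _ _ ()
  Eventually-∀ {suc m} h with Eventually-× (h zero) (Eventually-∀ (h ∘ suc))
  ... | N , p = N , λ n le → λ { zero → proj₁ (p n le) ; (suc i) → proj₂ (p n le) i }

  quarter : ℚ → ℚ
  quarter x = ½ * (½ * x)

  quarter-pos : ∀ {x} → 0ℚ < x → 0ℚ < quarter x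
  quarter-pos 0<x = *-pos 0<½ (*-pos 0<½ 0<x)
    where
    0<½ : 0ℚ < ½
    0<½ = ℚₚ.positive⁻¹ ½

  four-quarters : ∀ x → (quarter x + quarter x) + (quarter x + quarter x) ≡ x
  four-quarters = identity
    where
    identity : ∀ x → (½ * (½ * x) + ½ * (½ * x)) + (½ * (½ * x) + ½ * (½ * x)) ≡ x
    identity = solve-∀ ℚ-ring

  -- One late term decides: if it is below δ/2 in absolute value the tail stays below δ, and
  -- otherwise the tail stays above δ/4, contrary to the hypothesis.
  null-unless-apart : ∀ x → (∀ θ → 0ℚ < θ → ¬ Eventually (λ N → θ ≤ ∣ seq x N ∣ℚ)) → x ≈ᴿ 0ᴿ
  null-unless-apart x ¬apart δ 0<δ with cauchy x (quarter δ) (quarter-pos 0<δ)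
  ... | N , close with ∣ seq x N ∣ℚ ℚₚ.<? quarter δ + quarter δ
  ...   | yes small = N , λ n N≤n → begin-strict
    ∣ seq x n - 0ℚ ∣ℚ                              ≡⟨ cong ∣_∣ℚ (split (seq x n) (seq x N)) ⟩
    ∣ seq x N + (seq x n - seq x N) ∣ℚ             ≤⟨ ℚₚ.∣p+q∣≤∣p∣+∣q∣ (seq x N) _ ⟩
    ∣ seq x N ∣ℚ + ∣ seq x n - seq x N ∣ℚ          <⟨ ℚₚ.+-mono-< small (close n N N≤n ℕₚ.≤-refl) ⟩
    (quarter δ + quarter δ) + quarter δ
      ≤⟨ ℚₚ.+-monoʳ-≤ (quarter δ + quarter δ) (≤-from-gap _ (ℚₚ.<⇒≤ (quarter-pos 0<δ)) refl) ⟩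
    (quarter δ + quarter δ) + (quarter δ + quarter δ) ≡⟨ four-quarters δ ⟩
    δ                                              ∎
    where
    open ℚₚ.≤-Reasoning
    split : ∀ a b → a - 0ℚ ≡ b + (a - b)
    split = solve-∀ ℚ-ring
  ...   | no large = contradiction
      (N , λ n N≤n → ≤-from-gap _ (gap-nonneg (lower n N≤n)) (slack (quarter δ) ∣ seq x n ∣ℚ))
      (¬apart (quarter δ) (quarter-pos 0<δ))
    where
    open ℚₚ.≤-Reasoning
    slack : ∀ q y → y ≡ q + ((y + q) - (q + q))
    slack = solve-∀ ℚ-ring
    split : ∀ a b → b ≡ a - (a - b)
    split = solve-∀ ℚ-ring
    lower : ∀ n → N ℕ.≤ n → quarter δ + quarter δ ≤ ∣ seq x n ∣ℚ + quarter δ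
    lower n N≤n = begin
      quarter δ + quarter δ                      ≤⟨ ℚₚ.≮⇒≥ large ⟩
      ∣ seq x N ∣ℚ                               ≡⟨ cong ∣_∣ℚ (split (seq x n) (seq x N)) ⟩
      ∣ seq x n - (seq x n - seq x N) ∣ℚ         ≤⟨ ℚₚ.∣p-q∣≤∣p∣+∣q∣ (seq x n) _ ⟩
      ∣ seq x n ∣ℚ + ∣ seq x n - seq x N ∣ℚ
        ≤⟨ ℚₚ.+-monoʳ-≤ ∣ seq x n ∣ℚ (ℚₚ.<⇒≤ (close n N N≤n ℕₚ.≤-refl)) ⟩
      ∣ seq x n ∣ℚ + quarter δ                   ∎

  seq-sumᴿ : ∀ {n} (f : Fin n → ℝ) N → seq (sumᴿ f) N ≡ ∑ (λ i → seq (f i) N)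
  seq-sumᴿ {zero}  f N = refl
  seq-sumᴿ {suc n} f N = cong (seq (f zero) N +_) (seq-sumᴿ (f ∘ suc) N)

  ι-count : ∀ {A : Set} {P : Pred A 0ℓ} (P? : Decidable P) {n} (f : Fin n → A) →
            ι (Vec.count P? (Vec.tabulate f)) ≡ ∑ (λ i → ⟦ P? (f i) ⟧)
  ι-count P? {zero}  f = refl
  ι-count P? {suc n} f with does (P? (f zero))
  ... | true  = trans (ι-+ 1 (Vec.count P? (Vec.tabulate (f ∘ suc)))) (cong (1ℚ +_) (ι-count P? (f ∘ suc)))
  ... | false = trans (ι-count P? (f ∘ suc)) (sym (ℚₚ.+-identityˡ _))

  module Approximation {n} (G : Graph n) where
    open Graph G
    open Counting G

    -- The identity is exact at every index because the entries of Q are constant sequences.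
    seq-signlessLaplacian : ∀ (v : Fin n → ℝ) i N → seq ((signlessLaplacian G · v) i) N ≡
                            ∑ (a i) * seq (v i) N + ∑ (λ j → a i j * seq (v j) N)
    seq-signlessLaplacian v i N = begin
      seq ((signlessLaplacian G · v) i) N
        ≡⟨ seq-sumᴿ (λ j → signlessLaplacian G i j *ᴿ v j) N ⟩
      ∑ (λ j → (seq (degreeMatrix G i j) N + seq (adjacencyMatrix G i j) N) * seq (v j) N)
        ≡⟨ sum-cong-≗ (λ j → trans (cong₂ (λ d b → (d + b) * seq (v j) N) (degree-entry j) (adjacency-entry j))
             (expand ⟦ i Finₚ.≟ j ⟧ (∑ (a i)) (a i j) (seq (v j) N))) ⟩
      ∑ (λ j → ⟦ i Finₚ.≟ j ⟧ * (∑ (a i) * seq (v j) N) + a i j * seq (v j) N)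
        ≡⟨ ∑-distrib-+ (λ j → ⟦ i Finₚ.≟ j ⟧ * (∑ (a i) * seq (v j) N)) _ ⟩
      ∑ (λ j → ⟦ i Finₚ.≟ j ⟧ * (∑ (a i) * seq (v j) N)) + ∑ (λ j → a i j * seq (v j) N)
        ≡⟨ cong (_+ ∑ (λ j → a i j * seq (v j) N)) (∑-diagonal i (λ j → ∑ (a i) * seq (v j) N)) ⟩
      ∑ (a i) * seq (v i) N + ∑ (λ j → a i j * seq (v j) N) ∎
      where
      open ≡-Reasoning
      expand : ∀ χ d b y → (χ * d + b) * y ≡ χ * (d * y) + b * y
      expand = solve-∀ ℚ-ring
      adjacency-entry : ∀ j → seq (adjacencyMatrix G i j) N ≡ a i j
      adjacency-entry j with does (adj? i j)
      ... | true  = refl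
      ... | false = refl
      degree-entry : ∀ j → seq (degreeMatrix G i j) N ≡ ⟦ i Finₚ.≟ j ⟧ * ∑ (a i)
      degree-entry j = trans (select (does (i Finₚ.≟ j)) (degree G i))
        (cong (⟦ i Finₚ.≟ j ⟧ *_) (ι-count (adj? i) (λ j → j)))
        where
        select : ∀ b d → seq (if b then fromℕ d else 0ᴿ) N ≡ (if b then 1ℚ else 0ℚ) * ι d
        select true  d = sym (ℚₚ.*-identityˡ (ι d))
        select false d = sym (ℚₚ.*-zeroˡ (ι d))

  -- This is the factor `D * (η + η)` of `cliques-large`, written without a graph so that c can be
  -- fixed before n and G.
  rate : ℕ → ℚ → ℚ
  rate k η = (η * η) ^ suc k * (((η + η) + (η + η)) * ((η + η) + (η + η))) * (η + η)

  rate-pos : ∀ k {η} → 0ℚ < η → 0ℚ < rate k η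
  rate-pos k 0<η = *-pos (*-pos (^-pos (*-pos 0<η 0<η) (suc k)) (*-pos 0<4η 0<4η)) (ℚₚ.+-mono-< 0<η 0<η)
    where
    0<4η = ℚₚ.+-mono-< (ℚₚ.+-mono-< 0<η 0<η) (ℚₚ.+-mono-< 0<η 0<η)

  -- Choice of constants and the conclusion for real eigenvectors.

  module SpectralSupersaturation (k : ℕ) .{{_ : ℕ.NonZero k}} (2≤k : 2 ℕ.≤ k)
    (ε : ℝ) (γ : ℚ) (0<γ : 0ℚ < γ) (γ≤ε : Eventually (λ N → 0ℚ + γ ≤ seq ε N)) where

    -- `κ` is half of min(1, γ): the minimum keeps κ ≤ 1, and the half leaves room for the tolerance
    -- with which q is approximated.
    h η κ : ℚ
    h = ℤ.+ 1 / k
    η = quarter (½ * (1ℚ ⊓ γ))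
    κ = (η + η) + (η + η)

    0<min : 0ℚ < 1ℚ ⊓ γ
    0<min with ℚₚ.⊓-sel 1ℚ γ
    ... | inj₁ eq = subst (0ℚ <_) (sym eq) (ℚₚ.positive⁻¹ 1ℚ)
    ... | inj₂ eq = subst (0ℚ <_) (sym eq) 0<γ

    0<½min : 0ℚ < ½ * (1ℚ ⊓ γ)
    0<½min = *-pos (ℚₚ.positive⁻¹ ½) 0<min

    0<η : 0ℚ < η
    0<η = quarter-pos 0<½min

    κ≡½min : κ ≡ ½ * (1ℚ ⊓ γ)
    κ≡½min = four-quarters (½ * (1ℚ ⊓ γ))

    0<κ : 0ℚ < κ
    0<κ = subst (0ℚ <_) (sym κ≡½min) 0<½min

    2κ≡min : κ + κ ≡ 1ℚ ⊓ γ
    2κ≡min = trans (cong₂ _+_ κ≡½min κ≡½min) (double (1ℚ ⊓ γ))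
      where
      double : ∀ x → ½ * x + ½ * x ≡ x
      double = solve-∀ ℚ-ring

    2κ≤γ : κ + κ ≤ γ
    2κ≤γ = subst (_≤ γ) (sym 2κ≡min) (ℚₚ.p⊓q≤q 1ℚ γ)

    κ≤1 : κ ≤ 1ℚ
    κ≤1 = ℚₚ.≤-trans (≤-from-gap κ (ℚₚ.<⇒≤ 0<κ) refl) (subst (_≤ 1ℚ) (sym 2κ≡min) (ℚₚ.p⊓q≤p 1ℚ γ))

    0≤h : 0ℚ ≤ h
    0≤h = ℚₚ.nonNegative⁻¹ h {{ℚₚ.normalize-nonNeg 1 k}}

    2h≤1 : h + h ≤ 1ℚ
    2h≤1 = subst₂ _≤_ (double h) (1/k-inverse k) (ℚₚ.*-monoʳ-≤-nonNeg h {{nonNegative 0≤h}} (ι-mono 2≤k))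
      where
      double : ∀ x → (1ℚ + 1ℚ) * x ≡ x + x
      double = solve-∀ ℚ-ring

    instance
      factorial-pos : Positive (ι (suc k !))
      factorial-pos = positive (ι-pos (suc k !) {{suc k ℕₚ.!≢0}})
      factorial-nonZero : NonZero (ι (suc k !))
      factorial-nonZero = ℚₚ.pos⇒nonZero (ι (suc k !))

    C : ℚ
    C = rate k η * 1/ ι (suc k !)

    0<C : 0ℚ < C
    0<C = *-pos (rate-pos k 0<η) (ℚₚ.positive⁻¹ (1/ ι (suc k !)) {{ℚₚ.1/pos⇒pos (ι (suc k !))}})

    module _ {n} .{{_ : ℕ.NonZero n}} (G : Graph n) (q : ℝ)
      (q-large : (fromℚ (1ℚ - h) +ᴿ ε) *ᴿ fromℕ (2 ℕ.* n) ≤ᴿ q)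
      (v : Fin n → ℝ) (eigen : ∀ i → (signlessLaplacian G · v) i ≈ᴿ q *ᴿ v i) where
      open Counting G
      open Approximation G

      X : ℚ
      X = ι n

      1≤X : 1ℚ ≤ X
      1≤X = ι-mono (ℕ.>-nonZero⁻¹ n)

      -- Of the excess γ ≥ 2κ, one κ survives in the conclusion; the other contributes 2κn, which
      -- covers the tolerance κ because n ≥ 1.
      q-approx : ∀ {E Q} → 0ℚ + γ ≤ E → ((1ℚ - h) + E) * ι (2 ℕ.* n) ≤ Q + κ → ((1ℚ - h) + κ) * (X + X) ≤ Q
      q-approx {E} {Q} γ≤E le = ≤-from-gap _
        (+-nonneg (+-nonneg (gap-nonneg le′) (*-nonneg 0≤2X (gap-nonneg γ≤E)))
          (+-nonneg (*-nonneg 0≤2X (gap-nonneg 2κ≤γ))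
            (+-nonneg (*-nonneg (ℚₚ.<⇒≤ 0<κ) (gap-nonneg 1≤X)) (*-nonneg (ℚₚ.<⇒≤ 0<κ) 0≤X))))
        (slack h κ X E Q γ)
        where
        0≤X = ι-nonneg n
        0≤2X : 0ℚ ≤ X + X
        0≤2X = +-nonneg 0≤X 0≤X
        double : ∀ x → (1ℚ + 1ℚ) * x ≡ x + x
        double = solve-∀ ℚ-ring
        le′ : ((1ℚ - h) + E) * (X + X) ≤ Q + κ
        le′ = subst (λ x → ((1ℚ - h) + E) * x ≤ Q + κ) (trans (ι-* 2 n) (double X)) le
        slack : ∀ h κ X E Q γ → Q ≡ ((1ℚ - h) + κ) * (X + X) +
          (((Q + κ) - ((1ℚ - h) + E) * (X + X) + (X + X) * (E - (0ℚ + γ))) +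
            ((X + X) * (γ - (κ + κ)) + (κ * (X - 1ℚ) + κ * X)))
        slack = solve-∀ ℚ-ring

      module AtIndex (N : ℕ) {θ} (0<θ : 0ℚ < θ) (i : Fin n) (θ≤ : θ ≤ ∣ seq (v i) N ∣ℚ)
        (close : ∀ j → ∣ seq ((signlessLaplacian G · v) j) N - seq (q *ᴿ v j) N ∣ℚ < κ * θ)
        (μ-large : ((1ℚ - h) + κ) * (X + X) ≤ seq q N) where
        y e : Weight n
        y j = seq (v j) N
        e j = seq ((signlessLaplacian G · v) j) N - seq q N * y j

        open ApproximateEigenvector G {K = k} {h} {η} {seq q N} y e (1/k-inverse k) 0≤h 2h≤1 0<η κ≤1
          using (S; cliques-large)

        θ²≤S : θ * θ ≤ S
        θ²≤S = ℚₚ.≤-trans (square-mono (ℚₚ.<⇒≤ 0<θ) θ≤)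
          (ℚₚ.≤-trans (ℚₚ.≤-reflexive (∣x∣²≡x² (y i))) (member≤∑ (λ j → square-nonneg (y j)) i))

        e-eigen : ∀ j → ∑ (a j) * y j + ∑ (λ l → a j l * y l) ≡ seq q N * y j + e j
        e-eigen j = trans (sym (seq-signlessLaplacian v j N))
          (split (seq ((signlessLaplacian G · v) j) N) (seq q N * y j))
          where
          split : ∀ x z → x ≡ z + (x - z)
          split = solve-∀ ℚ-ring

        e² : ∀ j → e j * e j ≤ κ * κ * S
        e² j = begin
          e j * e j               ≡⟨ ∣x∣²≡x² (e j) ⟨
          ∣ e j ∣ℚ * ∣ e j ∣ℚ     ≤⟨ square-mono (ℚₚ.0≤∣p∣ (e j)) (ℚₚ.<⇒≤ (close j)) ⟩
          κ * θ * (κ * θ)         ≡⟨ regroup κ θ ⟩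
          κ * κ * (θ * θ)         ≤⟨ *-monoˡ (square-nonneg κ) θ²≤S ⟩
          κ * κ * S               ∎
          where
          open ℚₚ.≤-Reasoning
          regroup : ∀ κ θ → κ * θ * (κ * θ) ≡ κ * κ * (θ * θ)
          regroup = solve-∀ ℚ-ring

        conclusion : rate k η * ι (n ℕ.^ suc k) ≤ ι (suc k !) * ι (#cliques G (suc k))
        conclusion = cliques-large e-eigen e² μ-large (ℚₚ.<-≤-trans (*-pos 0<θ 0<θ) θ²≤S)

      Goal : Set
      Goal = C * ι (n ℕ.^ suc k) ≤ ι (#cliques G (suc k))

      apart⇒goal : ∀ i θ → 0ℚ < θ → Eventually (λ N → θ ≤ ∣ seq (v i) N ∣ℚ) → Goal
      apart⇒goal i θ 0<θ apart = *-cancelˡ (ℚₚ.positive⁻¹ (ι (suc k !))) (subst (_≤ _) scaled AtN.conclusion)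
        where
        -- The tolerance κθ is relative to the entry `v i`: as θ² ≤ S, it gives e² ≤ κ²S. Finitely
        -- many eventual conditions share an index N.
        all = Eventually-× apart (Eventually-× (Eventually-∀ λ j → eigen j (κ * θ) (*-pos 0<κ 0<θ))
                (Eventually-× γ≤ε (q-large κ 0<κ)))
        N = proj₁ all
        holds = proj₂ all N ℕₚ.≤-refl
        module AtN = AtIndex N 0<θ i (proj₁ holds) (proj₁ (proj₂ holds))
          (q-approx (proj₁ (proj₂ (proj₂ holds))) (proj₂ (proj₂ (proj₂ holds))))
        regroup : ∀ r f i x → r * x * (f * i) ≡ f * (r * i * x)
        regroup = solve-∀ ℚ-ring
        scaled : rate k η * ι (n ℕ.^ suc k) ≡ ι (suc k !) * (C * ι (n ℕ.^ suc k))
        scaled = trans (sym (trans (cong (rate k η * ι (n ℕ.^ suc k) *_) (ℚₚ.*-inverseʳ (ι (suc k !))))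
          (ℚₚ.*-identityʳ _)))
          (regroup (rate k η) (ι (suc k !)) (1/ ι (suc k !)) (ι (n ℕ.^ suc k)))

      -- The goal is a decidable statement about rationals, so v ≉ 0 may be used by contradiction.
      manyCliques : ¬ (∀ i → v i ≈ᴿ 0ᴿ) → Goal
      manyCliques v≉0 = decidable-stable (_ ℚₚ.≤? _) λ ¬goal →
        v≉0 λ i → null-unless-apart (v i) λ θ 0<θ apart → ¬goal (apart⇒goal i θ 0<θ apart)

  pointwise-≤ᴿ : ∀ x y → (∀ N → seq x N ≤ seq y N) → x ≤ᴿ y
  pointwise-≤ᴿ x y x≤y δ 0<δ = 0 , λ N _ → ℚₚ.≤-trans (x≤y N) (≤-from-gap δ (ℚₚ.<⇒≤ 0<δ) refl)

open import Data.Integer.Base using (+_)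
open import Data.Nat.Base using (ℕ; suc; _≤_; _+_; _*_; _^_; NonZero; >-nonZero)
open import Data.Nat.Properties using (+-comm)
open import Data.Product.Base using (_×_; _,_; ∃-syntax)
open import Data.Rational.Base using (1ℚ; _-_; _/_)
open import Data.Rational.Properties using (≤-reflexive; +-identityˡ)
open import Relation.Binary.PropositionalEquality using (subst; sym)

theorem2p2 : (k : ℕ) → .{{_ : NonZero k}} → 2 ≤ k → (ε : ℝ) → 0ᴿ <ᴿ ε →
    ∃[ c ] (0ᴿ <ᴿ c × ∃[ n₀ ] (∀ n → n₀ ≤ n → (G : Graph n) → (q : ℝ) →
    IsSignlessSpectralRadius G q →
    (fromℚ (1ℚ - + 1 / k) +ᴿ ε) *ᴿ fromℕ (2 * n) ≤ᴿ q →
    c *ᴿ fromℕ (n ^ (k + 1)) ≤ᴿ fromℕ (#cliques G (k + 1))))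
theorem2p2 k 2≤k ε (γ , 0<γ , γ≤ε) =
  fromℚ C , (C , 0<C , 0 , λ _ _ → ≤-reflexive (+-identityˡ C)) ,
  -- The threshold n₀ = 1 makes 1/n available and lets κ be absorbed into 2κn.
  1 , λ { n 1≤n G q ((v , v≉0 , eigen) , _) q-large →
    subst (λ r → fromℚ C *ᴿ fromℕ (n ^ r) ≤ᴿ fromℕ (#cliques G r)) (+-comm 1 k)
      (pointwise-≤ᴿ (fromℚ C *ᴿ fromℕ (n ^ suc k)) (fromℕ (#cliques G (suc k)))
        λ _ → manyCliques {{>-nonZero 1≤n}} G q q-large v eigen v≉0) }
  where
  open Supersaturation
  open SpectralSupersaturation k 2≤k ε γ 0<γ γ≤ε
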